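{- Let $q=3^k$. Then, as $n\to\infty$, $$EGZ(3,\mathbb{F}_{q}^{n},2) \leq \begin{cases} 8.315^{n+o(n)} & \text{for } k=2, \\ 21.802^{n+o(n)} &\text{for } k=3, \\ 58.557^{n+o(n)} &\text{for } k=4, \\ 159.812^{n+o(n)} &\text{for } k=5. \end{cases}$$
   Context: $\mathbb{F}_q^n$ is viewed as a commutative ring with coordinatewise operations. For elements $g_1,\dots,g_t$ of a commutative ring $R$, $e_m(g_1,\dots,g_t)=\sum_{1\leq i_1<\cdots<i_m\leq t}\prod_{j=1}^m g_{i_j}$; in particular $e_2(g_1,g_2,g_3)=g_1g_2+g_2g_3+g_3g_1$. A sequence over $R$ is a finite list of elements of $R$ (repetitions allowed); a subsequence of length $t$ is obtained by choosing $t$ distinct positions. For a finite commutative ring $R$, $EGZ(t,R,m)$ is the smallest positive integer $\ell$ such that every sequence $S$ over $R$ of length $|S|\geq \ell$ contains a subsequence $S'$ of length $t$ with $e_m(S')=0$ in $R$; if no such $\ell$ exists, $EGZ(t,R,m)=\infty$. -}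

module Defs where

open import Algebra.Bundles using (CommutativeRing)
import Algebra.Construct.Pointwise as Pointwise
import Algebra.Definitions as AlgebraDefinitions
import Algebra.Definitions.RawSemiring as RawSemiringDefinitions
open import Data.Fin.Base using (Fin)
open import Data.Integer.Base using (+_)
open import Data.List.Base using (List; []; _∷_; _++_; foldr; length; map)
open import Data.List.Relation.Binary.Sublist.Propositional using (_⊆_)
open import Data.Nat.Base using (ℕ; zero; suc; _+_; _*_; _≤_; _≥_; _>_)
open import Data.Product.Base using (_×_; ∃-syntax)
open import Data.Rational.Base as ℚ using (ℚ)
open import Function.Bundles using (Inverse)
open import Level using (Level; _⊔_)
open import Relation.Binary.PropositionalEquality using (_≡_; setoid)
open import Relation.Nullary.Negation.Core using (¬_)

private
  variable
    c ℓ : Level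

record IsFieldOfOrder (F : CommutativeRing c ℓ) (q : ℕ) : Set (c ⊔ ℓ) where
  private
    module F = CommutativeRing F
    open AlgebraDefinitions F._≈_ using (Invertible)
  field
    1≉0          : ¬ (F.1# F.≈ F.0#)
    ≉0⇒invertible : ∀ {x} → ¬ (x F.≈ F.0#) → Invertible F.1# F._*_ x
    enumeration  : Inverse F.setoid (setoid (Fin q))

Power : CommutativeRing c ℓ → ℕ → CommutativeRing c ℓ
Power R n = Pointwise.commutativeRing (Fin n) R

-- All subsequences of length m, one for each choice of positions
-- i₁ < ⋯ < iₘ, so repeated entries are counted with multiplicity.
subsequences : ∀ {a} {A : Set a} → ℕ → List A → List (List A)
subsequences zero    _        = [] ∷ []
subsequences (suc m) []       = []
subsequences (suc m) (x ∷ xs) =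
  map (x ∷_) (subsequences m xs) ++ subsequences (suc m) xs

module _ (R : CommutativeRing c ℓ) where
  private module R = CommutativeRing R

  e : ℕ → List R.Carrier → R.Carrier
  e m gs = foldr R._+_ R.0# (map (foldr R._*_ R.1#) (subsequences m gs))

HasEGZProperty : ℕ → CommutativeRing c ℓ → ℕ → ℕ → Set (c ⊔ ℓ)
HasEGZProperty t R m l =
  (S : List R.Carrier) → length S ≥ l →
  ∃[ S′ ] (S′ ⊆ S × length S′ ≡ t × e R m S′ R.≈ R.0#)
  where module R = CommutativeRing R

-- EGZ(t,R,m) = l for a finite value l.  The value ∞ corresponds to there
-- being no l with IsEGZ t R m l.
record IsEGZ (t : ℕ) (R : CommutativeRing c ℓ) (m l : ℕ) : Set (c ⊔ ℓ) where
  field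
    positive : l > 0
    property : HasEGZProperty t R m l
    minimal  : ∀ {l′} → l′ > 0 → HasEGZProperty t R m l′ → l ≤ l′

IsLittleO[n] : (ℕ → ℕ) → Set
IsLittleO[n] g = ∀ r → ∃[ N ] (∀ n → n ≥ N → r * g n ≤ n)

open RawSemiringDefinitions ℚ.+-*-rawSemiring using () renaming (_^_ to _^ℚ_)

-- EGZ(t,Rₙ,m) ≤ C^(n+o(n)) as n → ∞, intended for C > 1.  The error term may
-- then be taken ℕ-valued: rounding up the positive part of a real-valued o(n)
-- term leaves it o(n) and only increases the right-hand side.
EGZ[_,_,_]≤_^[n+o[n]] : ℕ → (ℕ → CommutativeRing c ℓ) → ℕ → ℚ → Set (c ⊔ ℓ)
EGZ[ t , R , m ]≤ C ^[n+o[n]] =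
  ∃[ g ] (IsLittleO[n] g ×
    ∃[ N ] (∀ n → n ≥ N →
      ∃[ l ] (IsEGZ t (R n) m l × (+ l ℚ./ 1) ℚ.≤ C ^ℚ (n + g n))))

{-# OPTIONS --safe #-}

-- Split a zero-free sequence S by the zero patterns of its vectors.  On one
-- pattern with m nonzero coordinates the tensor ∏ (1 - e₂ ^ (q - 1)) over these
-- coordinates is diagonal, so |S| is at most twice its slice rank (a vector
-- occurs at most twice, as e₂(x, x, x) = 0 in characteristic 3).  Since
-- q - 1 = Σ 2 · 3 ^ j and cubing is additive, e₂ ^ (q - 1) expands into products
-- of three monomials whose exponents have base-3 codigit sums (Σ (2 - digit))
-- adding up to 2 k per coordinate; hence in each product one factor has codigit
-- sum at most 2 k m / 3.  On nonzero values x ^ (q - 1) = 1, which removes the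
-- monomial of largest codigit sum.  A Chernoff bound with parameter
-- 0 < x < 1 counts these monomials, at most M ^ m of them for
-- M = ((1 + x + x ^ 2) ^ k - x ^ (2 k)) / x ^ (2 k / 3), and summing over all
-- patterns gives |S| ≤ 6 (1 + M) ^ n.
module Submission where

open import Defs
open import Algebra.Bundles using (CommutativeMonoid; CommutativeRing)
import Algebra.Definitions.RawSemiring as RawSemiringDefinitions
import Algebra.Properties.CommutativeMonoid.Sum as MonoidSum
import Algebra.Properties.Group as GroupProperties
import Algebra.Properties.Semiring.Exp as Exp
import Algebra.Properties.Semiring.Mult as Mult
import Algebra.Solver.Ring.NaturalCoefficients.Default as SemiringSolver
open import Data.Fin.Base as Fin using (Fin; punchIn)
open import Data.Fin.Permutation using (Permutation; permutation)
open import Data.Fin.Properties using (punchInᵢ≢i) renaming (_≟_ to _≟ᶠ_; all? to allFin?)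
open import Data.Integer.Base as ℤ using (+_)
import Data.Integer.Properties as ℤ
open import Data.List.Base
  using (List; []; _∷_; _++_; length; map; filter; drop; take; tabulate; allFin;
         cartesianProduct; cartesianProductWith)
open import Data.List.Properties using (length-++; length-map; length-take; length-tabulate; map-++)
open import Data.List.Membership.Propositional using (_∈_; find)
open import Data.List.Membership.Propositional.Properties
  using (∈-allFin; ∈-cartesianProduct⁺; ∈-cartesianProductWith⁺; ∈-cartesianProductWith⁻;
         ∈-filter⁺; ∈-filter⁻; ∈-map⁺; ∈-map⁻; ∈-tabulate⁺)
open import Data.List.Relation.Binary.Pointwise as Pointwise using (Pointwise; []; _∷_)
open import Data.List.Relation.Binary.Sublist.Propositional
  using (_⊆_; []; _∷_; _∷ʳ_; ⊆-trans; minimum; from∈)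
open import Data.List.Relation.Binary.Sublist.Propositional.Properties using (filter-⊆; take-⊆)
open import Data.List.Relation.Unary.All as All using (All; []; _∷_)
open import Data.List.Relation.Unary.All.Properties using (all-filter)
open import Data.List.Relation.Unary.Any as Any using (here; there)
open import Data.Nat.Base as ℕ using (ℕ; zero; suc; z≤n; s≤s)
import Data.Nat.DivMod as ℕ
open import Data.Nat.ListAction using (sum)
open import Data.Nat.ListAction.Properties using (sum-++)
import Data.Nat.Properties as ℕ
open import Algebra.Properties.CommutativeSemigroup ℕ.+-commutativeSemigroup
  using () renaming (interchange to +-interchange)
open import Data.Nat.Solver using (module +-*-Solver)
open import Data.Product.Base using (_×_; _,_; proj₁; proj₂; ∃-syntax)
import Data.Rational.Base as ℚ
import Data.Rational.Properties as ℚ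
open import Data.Rational.Unnormalised.Base as ℚᵘ using (mkℚᵘ; *≤*)
import Data.Rational.Unnormalised.Properties as ℚᵘ
open import Data.Sum.Base using (_⊎_; inj₁; inj₂; [_,_]′)
import Data.Vec.Functional as Vec
open import Function.Base using (_∘_)
open import Function.Bundles using (Inverse)
open import Level using (Level; _⊔_)
open import Relation.Binary.Bundles using (DecSetoid)
open import Relation.Binary.Definitions using (Decidable)
open import Relation.Binary.PropositionalEquality as ≡ using (_≡_; _≢_)
import Relation.Binary.Reasoning.Setoid as SetoidReasoning
open import Relation.Nullary.Decidable
  using (Dec; yes; no; ¬?; decidable-stable; map′; _⊎-dec_)
open import Relation.Nullary.Negation using (¬_; contradiction)
open import Relation.Unary using (Pred) renaming (Decidable to Decidable₁)

-- Finite fields of characteristic 3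

-- Splitting by zero patterns is forced: e₂(0, 0, z) = 0 for every z, so a coordinate that vanishes
-- for some vectors and not for others can leave nonzero entries off the diagonal. Where x is
-- nonzero, e₂(x, x, z) = x (x - z) vanishes only for z = x. Hence a common zero with two equal
-- vectors has all three equal, and a common zero at three distinct vectors is exactly what
-- zero-freeness forbids. Exponents are measured by digit sums because cubing sends e₂(x, y, z) to
-- e₂ of the cubes: each base-3 digit of q - 1 contributes its own copy of e₂ ^ 2, of degree 4 out
-- of the possible 3 · 2 = 6, and so the codegrees of the three factors at that digit add up to
-- exactly 2.

module FiniteField {c ℓ} (F : CommutativeRing c ℓ) (q : ℕ) (isField : IsFieldOfOrder F q) where

  open CommutativeRing F
  open IsFieldOfOrder isField public
  open Inverse enumeration using (to; from; to-cong; strictlyInverseˡ; strictlyInverseʳ)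
  open SetoidReasoning setoid
  private
    module Sum = MonoidSum +-commutativeMonoid
    module Prod = MonoidSum *-commutativeMonoid
  open Exp semiring using (_^_)
  open Mult semiring using () renaming (_×_ to _·_)

  infix 4 _≟_
  _≟_ : Decidable _≈_
  x ≟ y = map′ to-injective to-cong (to x ≟ᶠ to y)
    where
    to-injective : to x ≡ to y → x ≈ y
    to-injective eq = begin
      x            ≈⟨ strictlyInverseʳ x ⟨
      from (to x)  ≡⟨ ≡.cong from eq ⟩
      from (to y)  ≈⟨ strictlyInverseʳ y ⟩
      y            ∎

  elements : List Carrier
  elements = tabulate from

  elements-complete : ∀ x → ∃[ y ] (y ∈ elements × x ≈ y)
  elements-complete x = from (to x) , ∈-tabulate⁺ (to x) , sym (strictlyInverseʳ x)

  *-cancelˡ-≉0 : ∀ {x y z} → ¬ (x ≈ 0#) → x * y ≈ x * z → y ≈ z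
  *-cancelˡ-≉0 {x} {y} {z} x≉0 eq with ≉0⇒invertible x≉0
  ... | x⁻¹ , x⁻¹x≈1 , _ = begin
    y              ≈⟨ *-identityˡ y ⟨
    1# * y         ≈⟨ *-congʳ x⁻¹x≈1 ⟨
    x⁻¹ * x * y    ≈⟨ *-assoc _ _ _ ⟩
    x⁻¹ * (x * y)  ≈⟨ *-congˡ eq ⟩
    x⁻¹ * (x * z)  ≈⟨ *-assoc _ _ _ ⟨
    x⁻¹ * x * z    ≈⟨ *-congʳ x⁻¹x≈1 ⟩
    1# * z         ≈⟨ *-identityˡ z ⟩
    z              ∎

  *-≉0 : ∀ {x y} → ¬ (x ≈ 0#) → ¬ (y ≈ 0#) → ¬ (x * y ≈ 0#)
  *-≉0 x≉0 y≉0 xy≈0 = y≉0 (*-cancelˡ-≉0 x≉0 (trans xy≈0 (sym (zeroʳ _))))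

  ^-≈0 : ∀ x n → x ^ n ≈ 0# → x ≈ 0#
  ^-≈0 x zero    1≈0 = contradiction 1≈0 1≉0
  ^-≈0 x (suc n) eq with x ≟ 0#
  ... | yes x≈0 = x≈0
  ... | no  x≉0 = contradiction eq (*-≉0 x≉0 (x≉0 ∘ ^-≈0 x n))

  module _ (φ ψ : Carrier → Carrier)
           (φ-cong : ∀ {x y} → x ≈ y → φ x ≈ φ y) (ψ-cong : ∀ {x y} → x ≈ y → ψ x ≈ ψ y)
           (φψ : ∀ x → φ (ψ x) ≈ x) (ψφ : ∀ x → ψ (φ x) ≈ x) where

    private
      invˡ : ∀ i → to (φ (from (to (ψ (from i))))) ≡ i
      invˡ i = ≡.trans (to-cong (trans (φ-cong (strictlyInverseʳ _)) (φψ _))) (strictlyInverseˡ i)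

      invʳ : ∀ i → to (ψ (from (to (φ (from i))))) ≡ i
      invʳ i = ≡.trans (to-cong (trans (ψ-cong (strictlyInverseʳ _)) (ψφ _))) (strictlyInverseˡ i)

      π : Permutation q q
      π = permutation (to ∘ φ ∘ from) (to ∘ ψ ∘ from) invˡ invʳ

    module _ {a b} (M : CommutativeMonoid a b) where
      private
        module M = CommutativeMonoid M
        module ∑ = MonoidSum M

      -- Stated for any commutative monoid because it serves both the additive group, with
      -- translations, and the multiplicative monoid, with scalings.
      sum-reindex : (h : Carrier → M.Carrier) → (∀ {x y} → x ≈ y → h x M.≈ h y) →
                    ∑.sum (h ∘ from) M.≈ ∑.sum (h ∘ φ ∘ from)
      sum-reindex h h-cong = M.trans (∑.sum-permute (h ∘ from) π)
        (∑.sum-cong-≋ {q} (λ i → h-cong (strictlyInverseʳ _)))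

  -- Translation by 1 permutes the field, so the sum of all elements equals itself plus q · 1.
  order-·1≈0 : q · 1# ≈ 0#
  order-·1≈0 = sym (∙-cancelˡ (Sum.sum from) 0# (q · 1#) (begin
    Sum.sum from + 0#                             ≈⟨ +-identityʳ _ ⟩
    Sum.sum from                                  ≈⟨ sum-reindex (_+ 1#) (_+ - 1#) +-congʳ +-congʳ
                                                       (λ x → cancel x _ _ (-‿inverseˡ 1#))
                                                       (λ x → cancel x _ _ (-‿inverseʳ 1#))
                                                       +-commutativeMonoid (λ x → x) (λ eq → eq) ⟩
    Sum.sum (λ i → from i + 1#)                   ≈⟨ Sum.∑-distrib-+ from (λ _ → 1#) ⟩
    Sum.sum from + Sum.sum {q} (λ _ → 1#)         ≈⟨ +-congˡ (Sum.sum-replicate q) ⟩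
    Sum.sum from + q · 1#                         ∎))
    where
    open GroupProperties +-group using (∙-cancelˡ)
    cancel : ∀ x a b → a + b ≈ 0# → x + a + b ≈ x
    cancel x a b eq = trans (+-assoc x a b) (trans (+-congˡ eq) (+-identityʳ x))

  orZero : ∀ x → Dec (x ≈ 0#) → Carrier
  orZero x (yes _) = 1#
  orZero x (no _)  = x

  -- Sending 0 to the neutral element 1 lets the product of the nonzero elements run over the
  -- enumeration of the whole field. The same map later makes coordinate functions vanish nowhere.
  unitize : Carrier → Carrier
  unitize x = orZero x (x ≟ 0#)

  unitize-zero : ∀ {x} → x ≈ 0# → unitize x ≈ 1#
  unitize-zero {x} x≈0 with x ≟ 0#
  ... | yes _  = refl
  ... | no x≉0 = contradiction x≈0 x≉0

  unitize-nonzero : ∀ {x} → ¬ (x ≈ 0#) → unitize x ≈ x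
  unitize-nonzero {x} x≉0 with x ≟ 0#
  ... | yes x≈0 = contradiction x≈0 x≉0
  ... | no _    = refl

  unitize-cong : ∀ {x y} → x ≈ y → unitize x ≈ unitize y
  unitize-cong {x} {y} x≈y with x ≟ 0# | y ≟ 0#
  ... | yes _   | yes _   = refl
  ... | yes x≈0 | no y≉0  = contradiction (trans (sym x≈y) x≈0) y≉0
  ... | no x≉0  | yes y≈0 = contradiction (trans x≈y y≈0) x≉0
  ... | no _    | no _    = x≈y

  unitize≉0 : ∀ x → ¬ (unitize x ≈ 0#)
  unitize≉0 x with x ≟ 0#
  ... | yes _  = 1≉0
  ... | no x≉0 = x≉0

  prod≉0 : ∀ {n} (t : Fin n → Carrier) → (∀ i → ¬ (t i ≈ 0#)) → ¬ (Prod.sum t ≈ 0#)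
  prod≉0 {zero}  t t≉0 = 1≉0
  prod≉0 {suc n} t t≉0 = *-≉0 (t≉0 Fin.zero) (prod≉0 (t ∘ Fin.suc) (t≉0 ∘ Fin.suc))

  -- Multiplication by x permutes the field and fixes 0, so it permutes the
  -- nonzero elements; compare the products of all nonzero elements.
  ^-pred-order : ∀ {p} → q ≡ suc p → ∀ {x} → ¬ (x ≈ 0#) → x ^ p ≈ 1#
  ^-pred-order {p} ≡.refl {x} x≉0 with ≉0⇒invertible x≉0
  ... | x⁻¹ , x⁻¹x≈1 , xx⁻¹≈1 = sym (*-cancelˡ-≉0 (prod≉0 units (λ i → unitize≉0 _)) (begin
    P * 1#                                    ≈⟨ *-identityʳ P ⟩
    P                                         ≈⟨ *-identityˡ P ⟨
    1# * P                                    ≈⟨ *-congʳ (unitize-zero (strictlyInverseʳ 0#)) ⟨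
    unitize (from i₀) * P                     ≈⟨ Prod.sum-remove (unitize ∘ from) ⟨
    Prod.sum (unitize ∘ from)                 ≈⟨ sum-reindex (x *_) (x⁻¹ *_) *-congˡ *-congˡ
                                                  (cancel xx⁻¹≈1) (cancel x⁻¹x≈1)
                                                  *-commutativeMonoid unitize unitize-cong ⟩
    Prod.sum (unitize ∘ (x *_) ∘ from)        ≈⟨ Prod.sum-remove (unitize ∘ (x *_) ∘ from) ⟩
    unitize (x * from i₀) * Prod.sum (λ j → unitize (x * from (punchIn i₀ j)))
                                              ≈⟨ *-cong (unitize-zero x*from[i₀]≈0)
                                                        (Prod.sum-cong-≋ {p} scale) ⟩
    1# * Prod.sum (λ j → x * units j)         ≈⟨ *-identityˡ _ ⟩
    Prod.sum (λ j → x * units j)              ≈⟨ Prod.∑-distrib-+ (λ _ → x) units ⟩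
    Prod.sum {p} (λ _ → x) * P                ≈⟨ *-congʳ (Prod.sum-replicate p) ⟩
    x ^ p * P                                 ≈⟨ *-comm _ _ ⟩
    P * x ^ p                                 ∎))
    where
    i₀ = to 0#
    x*from[i₀]≈0 = trans (*-congˡ (strictlyInverseʳ 0#)) (zeroʳ x)
    units : Fin p → Carrier
    units j = unitize (from (punchIn i₀ j))
    P = Prod.sum units
    cancel : ∀ {a b} → a * b ≈ 1# → ∀ y → a * (b * y) ≈ y
    cancel eq y = trans (sym (*-assoc _ _ y)) (trans (*-congʳ eq) (*-identityˡ y))
    scale : ∀ j → unitize (x * from (punchIn i₀ j)) ≈ x * units j
    scale j = trans (unitize-nonzero (*-≉0 x≉0 unit≉0)) (*-congˡ (sym (unitize-nonzero unit≉0)))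
      where
      unit≉0 : ¬ (from (punchIn i₀ j) ≈ 0#)
      unit≉0 eq = punchInᵢ≢i i₀ j (≡.trans (≡.sym (strictlyInverseˡ _)) (to-cong eq))

  ^-order : ∀ {x} → ¬ (x ≈ 0#) → x ^ q ≈ x
  -- The element 0 shows that the order q is a successor, the form needed for `^-pred-order`.
  ^-order {x} x≉0 with inhabited⇒suc (to 0#)
    where
    inhabited⇒suc : ∀ {n} → Fin n → ∃[ p ] n ≡ suc p
    inhabited⇒suc {suc p} _ = p , ≡.refl
  ... | p , eq = begin
    x ^ q        ≡⟨ ≡.cong (x ^_) eq ⟩
    x * x ^ p    ≈⟨ *-congˡ (^-pred-order eq x≉0) ⟩
    x * 1#       ≈⟨ *-identityʳ x ⟩
    x            ∎

module Char3Field {c ℓ} (F : CommutativeRing c ℓ) (k : ℕ)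
                  (isField : IsFieldOfOrder F (3 ℕ.^ k)) where

  open CommutativeRing F
  open FiniteField F (3 ℕ.^ k) isField public
  open SetoidReasoning setoid
  open Exp semiring using (_^_; ^-assocʳ; ^-congˡ)
  open Mult semiring using (×1-homo-*) renaming (_×_ to _·_)
  open SemiringSolver commutativeSemiring using (solve; _:+_; _:*_; _:=_; con)

  private
    3^·1 : ∀ j → (3 ℕ.^ j) · 1# ≈ (3 · 1#) ^ j
    3^·1 zero    = +-identityʳ 1#
    3^·1 (suc j) = trans (×1-homo-* 3 (3 ℕ.^ j)) (*-congˡ (3^·1 j))

  -- The order gives (3 · 1) ^ k = 3 ^ k · 1 = 0, and a field has no nonzero nilpotents.
  3≈0 : 1# + (1# + 1#) ≈ 0#
  3≈0 = trans (+-congˡ (+-congˡ (sym (+-identityʳ 1#))))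
              (^-≈0 (3 · 1#) k (trans (sym (3^·1 k)) order-·1≈0))

  -- From here on 1 + 1 plays the part of -1, so that all identities can be stated by sums and
  -- products alone.
  x+2x≈0 : ∀ x → x + (1# + 1#) * x ≈ 0#
  x+2x≈0 x = trans (solve 1 (λ x → x :+ (con 1 :+ con 1) :* x := (con 1 :+ (con 1 :+ con 1)) :* x) refl x)
                   (trans (*-congʳ 3≈0) (zeroˡ x))

  cube : Carrier → Carrier
  cube x = x * (x * x)

  cube-cong : ∀ {x y} → x ≈ y → cube x ≈ cube y
  cube-cong eq = *-cong eq (*-cong eq eq)

  cube-* : ∀ x y → cube (x * y) ≈ cube x * cube y
  cube-* = solve 2 (λ x y → (x :* y) :* ((x :* y) :* (x :* y)) := (x :* (x :* x)) :* (y :* (y :* y))) refl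

  cube-+ : ∀ x y → cube (x + y) ≈ cube x + cube y
  cube-+ x y = begin
    cube (x + y)
      ≈⟨ solve 2 (λ x y → (x :+ y) :* ((x :+ y) :* (x :+ y)) :=
                          (x :* (x :* x) :+ y :* (y :* y)) :+
                          (con 1 :+ (con 1 :+ con 1)) :* (x :* (x :* y) :+ x :* (y :* y)))
                 refl x y ⟩
    cube x + cube y + (1# + (1# + 1#)) * (x * (x * y) + x * (y * y))
      ≈⟨ +-congˡ (trans (*-congʳ 3≈0) (zeroˡ _)) ⟩
    cube x + cube y + 0#
      ≈⟨ +-identityʳ _ ⟩
    cube x + cube y ∎

  -- x ^ (3 ^ j - 1), factored along 3 ^ j - 1 = Σ_{i<j} 2 · 3 ^ i.
  powerPred : ℕ → Carrier → Carrier
  powerPred zero    x = 1#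
  powerPred (suc j) x = (x * x) * powerPred j (cube x)

  powerPred-cong : ∀ j {x y} → x ≈ y → powerPred j x ≈ powerPred j y
  powerPred-cong zero    eq = refl
  powerPred-cong (suc j) eq = *-cong (*-cong eq eq) (powerPred-cong j (cube-cong eq))

  x*powerPred : ∀ j x → x * powerPred j x ≈ x ^ (3 ℕ.^ j)
  x*powerPred zero    x = refl
  x*powerPred (suc j) x = begin
    x * (x * x * powerPred j (cube x))  ≈⟨ *-assoc _ _ _ ⟨
    cube x * powerPred j (cube x)       ≈⟨ x*powerPred j (cube x) ⟩
    cube x ^ (3 ℕ.^ j)                  ≈⟨ ^-congˡ (3 ℕ.^ j) (*-congˡ (*-congˡ (*-identityʳ x))) ⟨
    (x ^ 3) ^ (3 ℕ.^ j)                 ≈⟨ ^-assocʳ x 3 (3 ℕ.^ j) ⟩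
    x ^ (3 ℕ.^ suc j)                   ∎

  powerPred-nonzero : ∀ {x} → ¬ (x ≈ 0#) → powerPred k x ≈ 1#
  powerPred-nonzero {x} x≉0 = *-cancelˡ-≉0 x≉0
    (trans (x*powerPred k x) (trans (^-order x≉0) (sym (*-identityʳ x))))

  -- The successor matters, as `powerPred zero` is constantly 1; for this reason the exponent enters
  -- as `suc k-1` from `Diagonalisation` on.
  powerPred-zero : ∀ j {x} → x ≈ 0# → powerPred (suc j) x ≈ 0#
  powerPred-zero j eq = trans (*-congʳ (trans (*-congʳ eq) (zeroˡ _))) (zeroˡ _)

-- Slice rank

length-filter-¬ : ∀ {a p} {A : Set a} {P : Pred A p} (P? : Decidable₁ P) xs →
                  length xs ≡ length (filter P? xs) ℕ.+ length (filter (¬? ∘ P?) xs)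
length-filter-¬ P? [] = ≡.refl
length-filter-¬ P? (x ∷ xs) with P? x
... | yes _ = ≡.cong suc (length-filter-¬ P? xs)
... | no  _ = ≡.trans (≡.cong suc (length-filter-¬ P? xs)) (≡.sym (ℕ.+-suc _ _))

module SliceRank {c ℓ a b} (F : CommutativeRing c ℓ) (k : ℕ)
                 (isField : IsFieldOfOrder F (3 ℕ.^ k)) (DX : DecSetoid a b) where

  open CommutativeRing F
  open Char3Field F k isField
  open DecSetoid DX using ()
    renaming (Carrier to X; _≈_ to _~_; _≟_ to _~?_; refl to ~-refl; sym to ~-sym; trans to ~-trans)
  open SetoidReasoning setoid
  open SemiringSolver commutativeSemiring using (solve; _:+_; _:*_; _:=_; con)

  Tensor : Set _
  Tensor = X → X → X → Carrier

  data Axis : Set where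
    axis₁ axis₂ axis₃ : Axis

  -- The arguments of `g` stay in cyclic order, so that `rotate` moves a slice to the next axis with
  -- the same `f` and `g`.
  slice : Axis → (X → Carrier) → (X → X → Carrier) → Tensor
  slice axis₁ f g x y z = f x * g y z
  slice axis₂ f g x y z = f y * g z x
  slice axis₃ f g x y z = f z * g x y

  data SliceRank≤ : ℕ → Tensor → Set (a ⊔ c ⊔ ℓ) where
    null   : ∀ {T} → (∀ x y z → T x y z ≈ 0#) → SliceRank≤ 0 T
    slice+ : ∀ {r T T′} axis f g → (∀ x y z → T x y z ≈ slice axis f g x y z + T′ x y z) →
             SliceRank≤ r T′ → SliceRank≤ (suc r) T

  rotate : Tensor → Tensor
  rotate T x y z = T y z x

  rotate-rank : ∀ {r T} → SliceRank≤ r T → SliceRank≤ r (rotate T)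
  rotate-rank (null T≈0)           = null λ x y z → T≈0 y z x
  rotate-rank (slice+ axis₁ f g T≈ sr) = slice+ axis₂ f g (λ x y z → T≈ y z x) (rotate-rank sr)
  rotate-rank (slice+ axis₂ f g T≈ sr) = slice+ axis₃ f g (λ x y z → T≈ y z x) (rotate-rank sr)
  rotate-rank (slice+ axis₃ f g T≈ sr) = slice+ axis₁ f g (λ x y z → T≈ y z x) (rotate-rank sr)

  module _ (m : X → Carrier) (x₀ : X) where

    addMultiple : Tensor → Tensor
    addMultiple T x y z = T x y z + m x * T x₀ y z

    -- The operation is linear and acts on the first argument only: it changes `f` in slices along
    -- the first axis and `g` in all others, and never adds a slice.
    addMultiple-rank : ∀ {r T} → SliceRank≤ r T → SliceRank≤ r (addMultiple T)
    addMultiple-rank (null T≈0) = null λ x y z →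
      trans (+-cong (T≈0 x y z) (trans (*-congˡ (T≈0 x₀ y z)) (zeroʳ _))) (+-identityʳ 0#)
    addMultiple-rank (slice+ {T′ = T′} axis₁ f g T≈ sr) =
      slice+ axis₁ (λ x → f x + m x * f x₀) g
        (λ x y z → trans (+-cong (T≈ x y z) (*-congˡ (T≈ x₀ y z)))
          (solve 6 (λ p r s t u v → (p :* r :+ s) :+ t :* (u :* r :+ v) := (p :+ t :* u) :* r :+ (s :+ t :* v))
             refl (f x) (g y z) (T′ x y z) (m x) (f x₀) (T′ x₀ y z)))
        (addMultiple-rank sr)
    addMultiple-rank (slice+ {T′ = T′} axis₂ f g T≈ sr) =
      slice+ axis₂ f (λ z x → g z x + m x * g z x₀)
        (λ x y z → trans (+-cong (T≈ x y z) (*-congˡ (T≈ x₀ y z)))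
          (solve 6 (λ p r s t u v → (p :* r :+ s) :+ t :* (p :* u :+ v) := p :* (r :+ t :* u) :+ (s :+ t :* v))
             refl (f y) (g z x) (T′ x y z) (m x) (g z x₀) (T′ x₀ y z)))
        (addMultiple-rank sr)
    addMultiple-rank (slice+ {T′ = T′} axis₃ f g T≈ sr) =
      slice+ axis₃ f (λ x y → g x y + m x * g x₀ y)
        (λ x y z → trans (+-cong (T≈ x y z) (*-congˡ (T≈ x₀ y z)))
          (solve 6 (λ p r s t u v → (p :* r :+ s) :+ t :* (p :* u :+ v) := p :* (r :+ t :* u) :+ (s :+ t :* v))
             refl (f z) (g x y) (T′ x y z) (m x) (g x₀ y) (T′ x₀ y z)))
        (addMultiple-rank sr)

  record Diagonal (T : Tensor) (S : List X) : Set (a ⊔ b ⊔ ℓ) where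
    field
      on  : ∀ {x} → x ∈ S → ¬ (T x x x ≈ 0#)
      off : ∀ {x y z} → x ∈ S → y ∈ S → z ∈ S → ¬ (x ~ y × y ~ z) → T x y z ≈ 0#
  open Diagonal

  rotate-diagonal : ∀ {T S} → Diagonal T S → Diagonal (rotate T) S
  rotate-diagonal d .on = d .on
  rotate-diagonal d .off x∈S y∈S z∈S ≁ = d .off y∈S z∈S x∈S
    λ (y~z , z~x) → ≁ (~-sym (~-trans y~z z~x) , y~z)

  NoTriple : List X → Set _
  NoTriple S = ∀ {x y z} → x ∷ y ∷ z ∷ [] ⊆ S → ¬ (x ~ y × y ~ z)

  class≤2 : ∀ {S} → NoTriple S → ∀ x₀ → length (filter (_~? x₀) S) ℕ.≤ 2
  class≤2 {S} noTriple x₀ = bound _ (all-filter (_~? x₀) S) (filter-⊆ (_~? x₀) S)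
    where
    bound : ∀ R → All (_~ x₀) R → R ⊆ S → length R ℕ.≤ 2
    bound []          _ _ = z≤n
    bound (_ ∷ [])    _ _ = s≤s z≤n
    bound (_ ∷ _ ∷ []) _ _ = s≤s (s≤s z≤n)
    bound (x ∷ y ∷ z ∷ R) (x~ ∷ y~ ∷ z~ ∷ _) R⊆S = contradiction (~-trans x~ (~-sym y~) , ~-trans y~ (~-sym z~))
      (noTriple (⊆-trans (≡.refl ∷ ≡.refl ∷ ≡.refl ∷ minimum R) R⊆S))

  -- The factor 2 accounts for multiplicity: one slice is spent on a whole class of equal entries,
  -- which fills at most two positions.
  Bound : ℕ → Set _
  Bound r = ∀ {T S} → SliceRank≤ r T → Diagonal T S → NoTriple S → length S ℕ.≤ r ℕ.* 2

  -- Gaussian elimination: if f x₀ ≉ 0, then adding multiples of the plane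
  -- T x₀ kills the slice, and does not change T away from x₀ because there
  -- the plane T x₀ vanishes.
  eliminate : ∀ {r} → Bound r → ∀ {T T′ S} (f : X → Carrier) (g : X → X → Carrier) →
              (∀ x y z → T x y z ≈ f x * g y z + T′ x y z) →
              SliceRank≤ r T′ → Diagonal T S → NoTriple S → length S ℕ.≤ suc r ℕ.* 2
  eliminate {r} bound {T} {T′} {S} f g T≈ sr diag noTriple with Any.any? (λ x → ¬? (f x ≟ 0#)) S
  ... | no none = ℕ.m≤n⇒m≤o+n 2 (bound sr diag′ noTriple)
    where
    T≈T′ : ∀ {x} → x ∈ S → ∀ y z → T x y z ≈ T′ x y z
    T≈T′ {x} x∈S y z = begin
      T x y z                ≈⟨ T≈ x y z ⟩
      f x * g y z + T′ x y z ≈⟨ +-congʳ (trans (*-congʳ fx≈0) (zeroˡ _)) ⟩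
      0# + T′ x y z          ≈⟨ +-identityˡ _ ⟩
      T′ x y z               ∎
      where
      fx≈0 : f x ≈ 0#
      fx≈0 = decidable-stable (f x ≟ 0#) λ fx≉0 → none (Any.map (λ { ≡.refl → fx≉0 }) x∈S)
    diag′ : Diagonal T′ S
    diag′ .on x∈S eq = diag .on x∈S (trans (T≈T′ x∈S _ _) eq)
    diag′ .off x∈S y∈S z∈S ≁ = trans (sym (T≈T′ x∈S _ _)) (diag .off x∈S y∈S z∈S ≁)
  ... | yes some with find some
  ... | x₀ , x₀∈S , fx₀≉0 with ≉0⇒invertible fx₀≉0
  ... | inv , inv*fx₀≈1 , _ = ℕ.≤-trans (ℕ.≤-reflexive (length-filter-¬ (_~? x₀) S))
    (ℕ.+-mono-≤ (class≤2 noTriple x₀) (bound (addMultiple-rank m x₀ sr) diag′ noTriple′))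
    where
    S′ = filter (¬? ∘ (_~? x₀)) S
    -- This is - f x / f x₀, the multiple for which the coefficient of the slice vanishes.
    m : X → Carrier
    m x = (1# + 1#) * (f x * inv)
    cancels : ∀ x → f x + m x * f x₀ ≈ 0#
    cancels x = begin
      f x + m x * f x₀                      ≈⟨ solve 3 (λ u v w →
                                                  u :+ ((con 1 :+ con 1) :* (u :* v)) :* w :=
                                                  u :+ (con 1 :+ con 1) :* (u :* (v :* w)))
                                                  refl (f x) inv (f x₀) ⟩
      f x + (1# + 1#) * (f x * (inv * f x₀)) ≈⟨ +-congˡ (*-congˡ (trans (*-congˡ inv*fx₀≈1) (*-identityʳ _))) ⟩
      f x + (1# + 1#) * f x                 ≈⟨ x+2x≈0 (f x) ⟩
      0#                                    ∎
    T≈′ : ∀ {x y z} → x ∈ S′ → y ∈ S′ → z ∈ S′ → T x y z ≈ addMultiple m x₀ T′ x y z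
    T≈′ {x} {y} {z} x∈ y∈ z∈ with ∈-filter⁻ (¬? ∘ (_~? x₀)) {xs = S} y∈ | ∈-filter⁻ (¬? ∘ (_~? x₀)) {xs = S} z∈
    ... | y∈S , y≁x₀ | z∈S , _ = begin
      T x y z                               ≈⟨ +-identityʳ _ ⟨
      T x y z + 0#                          ≈⟨ +-congˡ (trans (*-congˡ Tx₀yz≈0) (zeroʳ _)) ⟨
      T x y z + m x * T x₀ y z              ≈⟨ +-cong (T≈ x y z) (*-congˡ (T≈ x₀ y z)) ⟩
      (f x * g y z + T′ x y z) + m x * (f x₀ * g y z + T′ x₀ y z)
                                            ≈⟨ solve 6 (λ p r s t u v →
                                                 (p :* r :+ s) :+ t :* (u :* r :+ v) :=
                                                 (p :+ t :* u) :* r :+ (s :+ t :* v))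
                                                 refl (f x) (g y z) (T′ x y z) (m x) (f x₀) (T′ x₀ y z) ⟩
      (f x + m x * f x₀) * g y z + addMultiple m x₀ T′ x y z
                                            ≈⟨ +-congʳ (trans (*-congʳ (cancels x)) (zeroˡ _)) ⟩
      0# + addMultiple m x₀ T′ x y z        ≈⟨ +-identityˡ _ ⟩
      addMultiple m x₀ T′ x y z             ∎
      where
      Tx₀yz≈0 = diag .off x₀∈S y∈S z∈S λ (x₀~y , _) → y≁x₀ (~-sym x₀~y)
    S′⊆S : ∀ {x} → x ∈ S′ → x ∈ S
    S′⊆S x∈ = proj₁ (∈-filter⁻ (¬? ∘ (_~? x₀)) x∈)
    diag′ : Diagonal (addMultiple m x₀ T′) S′
    diag′ .on x∈ eq = diag .on (S′⊆S x∈) (trans (T≈′ x∈ x∈ x∈) eq)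
    diag′ .off x∈ y∈ z∈ ≁ = trans (sym (T≈′ x∈ y∈ z∈)) (diag .off (S′⊆S x∈) (S′⊆S y∈) (S′⊆S z∈) ≁)
    noTriple′ : NoTriple S′
    noTriple′ R⊆S′ = noTriple (⊆-trans R⊆S′ (filter-⊆ (¬? ∘ (_~? x₀)) S))

  -- Each step eliminates along the first axis; a slice along another axis is rotated there, since
  -- diagonality is invariant under cyclic shifts.
  sliceRank-bound : ∀ r → Bound r
  sliceRank-bound zero {S = []} (null T≈0) diag _ = z≤n
  sliceRank-bound zero {S = x ∷ S} (null T≈0) diag _ = contradiction (T≈0 x x x) (diag .on (here ≡.refl))
  sliceRank-bound (suc r) (slice+ axis₁ f g T≈ sr) diag =
    eliminate (sliceRank-bound r) f g T≈ sr diag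
  sliceRank-bound (suc r) (slice+ axis₂ f g T≈ sr) diag =
    eliminate (sliceRank-bound r) f g (λ x y z → T≈ z x y) (rotate-rank (rotate-rank sr))
      (rotate-diagonal (rotate-diagonal diag))
  sliceRank-bound (suc r) (slice+ axis₃ f g T≈ sr) diag =
    eliminate (sliceRank-bound r) f g (λ x y z → T≈ y z x) (rotate-rank sr)
      (rotate-diagonal diag)

-- Expansions into monomials and their slice rank

length-cartesianProduct : ∀ {a b} {A : Set a} {B : Set b} (xs : List A) (ys : List B) →
                          length (cartesianProduct xs ys) ≡ length xs ℕ.* length ys
length-cartesianProduct []       ys = ≡.refl
length-cartesianProduct (x ∷ xs) ys = ≡.trans (length-++ (map (x ,_) ys))
  (≡.cong₂ ℕ._+_ (length-map (x ,_) ys) (length-cartesianProduct xs ys))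

module Expansion {c ℓ a b} (F : CommutativeRing c ℓ) (k : ℕ)
                 (isField : IsFieldOfOrder F (3 ℕ.^ k)) (DX : DecSetoid a b) where

  open CommutativeRing F
  open Char3Field F k isField
  open SliceRank F k isField DX public
  open DecSetoid DX using () renaming (Carrier to X)
  open SemiringSolver commutativeSemiring using (solve; _:+_; _:*_; _:=_; con)

  -- The exponent data are formal: a function on a finite field does not determine them, and the
  -- reduction `≼` depends on exchanging monomials that agree as functions but differ in codegree.
  record Monomial : Set (a ⊔ c) where
    constructor monomial
    field
      fun         : X → Carrier
      codeg deg   : ℕ
  open Monomial public

  infixl 7 _⊗_ _⊠_
  _⊗_ : Monomial → Monomial → Monomial
  monomial f w d ⊗ monomial f′ w′ d′ = monomial (λ x → f x * f′ x) (w ℕ.+ w′) (d ℕ.+ d′)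

  _⊠_ : List Monomial → List Monomial → List Monomial
  _⊠_ = cartesianProductWith _⊗_

  -- Bounding the joint codegree of the three factors is stable under products, where the bounds
  -- add, and is what the pigeonhole argument consumes.
  data Span (Φ : List Monomial) (W : ℕ) (T : Tensor) : Set (a ⊔ c ⊔ ℓ) where
    term : ∀ m {p q r} → p ∈ Φ → q ∈ Φ → r ∈ Φ → codeg p ℕ.+ codeg q ℕ.+ codeg r ℕ.≤ W →
           (∀ x y z → T x y z ≈ m * (fun p x * (fun q y * fun r z))) → Span Φ W T
    plus : ∀ {U V} → Span Φ W U → Span Φ W V → (∀ x y z → T x y z ≈ U x y z + V x y z) → Span Φ W T

  span-* : ∀ {Φ Ψ W V T U Z} → Span Φ W T → Span Ψ V U → (∀ x y z → Z x y z ≈ T x y z * U x y z) →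
           Span (Φ ⊠ Ψ) (W ℕ.+ V) Z
  span-* (plus t t′ T≈) u Z≈ =
    plus (span-* t u (λ _ _ _ → refl)) (span-* t′ u (λ _ _ _ → refl))
      (λ x y z → trans (Z≈ x y z) (trans (*-congʳ (T≈ x y z)) (distribʳ _ _ _)))
  span-* t@(term _ _ _ _ _ _) (plus u u′ U≈) Z≈ =
    plus (span-* t u (λ _ _ _ → refl)) (span-* t u′ (λ _ _ _ → refl))
      (λ x y z → trans (Z≈ x y z) (trans (*-congˡ (U≈ x y z)) (distribˡ _ _ _)))
  span-* {W = W} {V} (term m {p} {q} {r} p∈ q∈ r∈ w≤ T≈) (term m′ {p′} {q′} {r′} p′∈ q′∈ r′∈ w′≤ U≈) Z≈ =
    term (m * m′) (∈-cartesianProductWith⁺ _⊗_ p∈ p′∈) (∈-cartesianProductWith⁺ _⊗_ q∈ q′∈)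
      (∈-cartesianProductWith⁺ _⊗_ r∈ r′∈)
      (≡.subst (ℕ._≤ W ℕ.+ V)
        (S.solve 6 (λ p q r p′ q′ r′ → (p S.:+ q S.:+ r) S.:+ (p′ S.:+ q′ S.:+ r′) S.:=
                     (p S.:+ p′) S.:+ (q S.:+ q′) S.:+ (r S.:+ r′)) ≡.refl
           (codeg p) (codeg q) (codeg r) (codeg p′) (codeg q′) (codeg r′))
        (ℕ.+-mono-≤ w≤ w′≤))
      (λ x y z → trans (Z≈ x y z) (trans (*-cong (T≈ x y z) (U≈ x y z))
        (solve 8 (λ m p q r m′ p′ q′ r′ → (m :* (p :* (q :* r))) :* (m′ :* (p′ :* (q′ :* r′))) :=
                    (m :* m′) :* ((p :* p′) :* ((q :* q′) :* (r :* r′)))) refl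
           m (fun p x) (fun q y) (fun r z) m′ (fun p′ x) (fun q′ y) (fun r′ z))))
    where module S = +-*-Solver

  -- The codegree may only drop, so a bound on joint codegrees survives the exchange.
  _≼_ : List Monomial → List Monomial → Set _
  Φ ≼ Ψ = ∀ {p} → p ∈ Φ → ∃[ p′ ] (p′ ∈ Ψ × codeg p′ ℕ.≤ codeg p × (∀ x → fun p x ≈ fun p′ x))

  span-≼ : ∀ {Φ Ψ W T} → Φ ≼ Ψ → Span Φ W T → Span Ψ W T
  span-≼ Φ≼Ψ (plus t u T≈) = plus (span-≼ Φ≼Ψ t) (span-≼ Φ≼Ψ u) T≈
  span-≼ Φ≼Ψ (term m p∈ q∈ r∈ w≤ T≈) with Φ≼Ψ p∈ | Φ≼Ψ q∈ | Φ≼Ψ r∈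
  ... | _ , p′∈ , p≤ , p≈ | _ , q′∈ , q≤ , q≈ | _ , r′∈ , r≤ , r≈ =
    term m p′∈ q′∈ r′∈ (ℕ.≤-trans (ℕ.+-mono-≤ (ℕ.+-mono-≤ p≤ q≤) r≤) w≤)
      (λ x y z → trans (T≈ x y z) (*-congˡ (*-cong (p≈ x) (*-cong (q≈ y) (r≈ z)))))

  -- Fixing the list of axes and functions in advance makes sums merge the terms that share a
  -- factor. The rank is then governed by the number of monomials and not by the number of terms.
  data Sliced : List (Axis × Monomial) → Tensor → Set (a ⊔ c ⊔ ℓ) where
    []   : ∀ {T} → (∀ x y z → T x y z ≈ 0#) → Sliced [] T
    cons : ∀ {ax p σ T T′} g → (∀ x y z → T x y z ≈ slice ax (fun p) g x y z + T′ x y z) →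
           Sliced σ T′ → Sliced ((ax , p) ∷ σ) T

  slice-+ : ∀ ax f g h x y z →
            slice ax f g x y z + slice ax f h x y z ≈ slice ax f (λ u v → g u v + h u v) x y z
  slice-+ axis₁ f g h x y z = sym (distribˡ _ _ _)
  slice-+ axis₂ f g h x y z = sym (distribˡ _ _ _)
  slice-+ axis₃ f g h x y z = sym (distribˡ _ _ _)

  slice-0 : ∀ ax f x y z → slice ax f (λ _ _ → 0#) x y z ≈ 0#
  slice-0 axis₁ f x y z = zeroʳ _
  slice-0 axis₂ f x y z = zeroʳ _
  slice-0 axis₃ f x y z = zeroʳ _

  sliced-+ : ∀ {σ T U V} → Sliced σ T → Sliced σ U → (∀ x y z → V x y z ≈ T x y z + U x y z) → Sliced σ V
  sliced-+ ([] T≈0) ([] U≈0) V≈ =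
    [] λ x y z → trans (V≈ x y z) (trans (+-cong (T≈0 x y z) (U≈0 x y z)) (+-identityʳ 0#))
  sliced-+ (cons {ax} {p} g T≈ t) (cons h U≈ u) V≈ =
    cons (λ u v → g u v + h u v) (λ x y z → trans (V≈ x y z) (trans (+-cong (T≈ x y z) (U≈ x y z))
      (trans (solve 4 (λ s t s′ t′ → (s :+ t) :+ (s′ :+ t′) := (s :+ s′) :+ (t :+ t′)) refl _ _ _ _)
             (+-congʳ (slice-+ ax (fun p) g h x y z)))))
      (sliced-+ t u (λ _ _ _ → refl))

  sliced-0 : ∀ σ {T} → (∀ x y z → T x y z ≈ 0#) → Sliced σ T
  sliced-0 []             T≈0 = [] T≈0
  sliced-0 ((ax , p) ∷ σ) T≈0 = cons (λ _ _ → 0#)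
    (λ x y z → trans (T≈0 x y z) (sym (trans (+-identityʳ _) (slice-0 ax (fun p) x y z))))
    (sliced-0 σ (λ _ _ _ → refl))

  sliced-∈ : ∀ {σ ax p T} g → (ax , p) ∈ σ → (∀ x y z → T x y z ≈ slice ax (fun p) g x y z) → Sliced σ T
  sliced-∈ {σ = _ ∷ σ} g (here ≡.refl) T≈ =
    cons g (λ x y z → trans (T≈ x y z) (sym (+-identityʳ _))) (sliced-0 σ (λ _ _ _ → refl))
  sliced-∈ {σ = (ax , p) ∷ σ} g (there i) T≈ = cons (λ _ _ → 0#)
    (λ x y z → sym (trans (+-congʳ (slice-0 ax (fun p) x y z)) (+-identityˡ _))) (sliced-∈ g i T≈)

  sliced-rank : ∀ {σ T} → Sliced σ T → SliceRank≤ (length σ) T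
  sliced-rank ([] T≈0)                  = null T≈0
  sliced-rank (cons {ax} {p} g T≈ t) = slice+ ax (fun p) g T≈ (sliced-rank t)

  low : ℕ → List Monomial → List Monomial
  low W = filter (λ p → 3 ℕ.* codeg p ℕ.≤? W)

  private
    pigeonhole : ∀ {W} u v w → u ℕ.+ v ℕ.+ w ℕ.≤ W → 3 ℕ.* u ℕ.≤ W ⊎ 3 ℕ.* v ℕ.≤ W ⊎ 3 ℕ.* w ℕ.≤ W
    pigeonhole {W} u v w u+v+w≤W with 3 ℕ.* u ℕ.≤? W | 3 ℕ.* v ℕ.≤? W | 3 ℕ.* w ℕ.≤? W
    ... | yes p | _     | _     = inj₁ p
    ... | no _  | yes p | _     = inj₂ (inj₁ p)
    ... | no _  | no _  | yes p = inj₂ (inj₂ p)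
    ... | no p  | no q  | no r  = contradiction
      (ℕ.+-mono-≤ (ℕ.+-mono-≤ (ℕ.≰⇒> p) (ℕ.≰⇒> q)) (ℕ.≰⇒> r))
      (ℕ.<⇒≱ (ℕ.≤-<-trans 3*sum≤ (ℕ.+-mono-< (ℕ.+-mono-< (ℕ.n<1+n W) (ℕ.n<1+n W)) (ℕ.n<1+n W))))
      where
      open +-*-Solver renaming (solve to solveℕ; _:+_ to _:+ℕ_; _:*_ to _:*ℕ_; _:=_ to _:=ℕ_; con to conℕ)
      3*sum≤ : 3 ℕ.* u ℕ.+ 3 ℕ.* v ℕ.+ 3 ℕ.* w ℕ.≤ W ℕ.+ W ℕ.+ W
      3*sum≤ = ≡.subst₂ ℕ._≤_
        (solveℕ 3 (λ u v w → (u :+ℕ v :+ℕ w) :+ℕ (u :+ℕ v :+ℕ w) :+ℕ (u :+ℕ v :+ℕ w) :=ℕ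
                      conℕ 3 :*ℕ u :+ℕ conℕ 3 :*ℕ v :+ℕ conℕ 3 :*ℕ w) ≡.refl u v w)
        ≡.refl (ℕ.+-mono-≤ (ℕ.+-mono-≤ u+v+w≤W u+v+w≤W) u+v+w≤W)

  axes : List Axis
  axes = axis₁ ∷ axis₂ ∷ axis₃ ∷ []

  span-sliced : ∀ {Φ W T} → Span Φ W T → Sliced (cartesianProduct axes (low W Φ)) T
  span-sliced {Φ} {W} (plus t u T≈) = sliced-+ (span-sliced t) (span-sliced u) T≈
  span-sliced {Φ} {W} (term m {p} {q} {r} p∈ q∈ r∈ w≤ T≈)
    with pigeonhole (codeg p) (codeg q) (codeg r) w≤
  ... | inj₁ low-p = sliced-∈ (λ y z → m * (fun q y * fun r z))
    (∈-cartesianProduct⁺ {xs = axes} (here ≡.refl) (∈-filter⁺ (λ p → 3 ℕ.* codeg p ℕ.≤? W) p∈ low-p))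
    (λ x y z → trans (T≈ x y z)
      (solve 4 (λ m p q r → m :* (p :* (q :* r)) := p :* (m :* (q :* r))) refl m (fun p x) (fun q y) (fun r z)))
  ... | inj₂ (inj₁ low-q) = sliced-∈ (λ z x → m * (fun p x * fun r z))
    (∈-cartesianProduct⁺ {xs = axes} (there (here ≡.refl)) (∈-filter⁺ (λ p → 3 ℕ.* codeg p ℕ.≤? W) q∈ low-q))
    (λ x y z → trans (T≈ x y z)
      (solve 4 (λ m p q r → m :* (p :* (q :* r)) := q :* (m :* (p :* r))) refl m (fun p x) (fun q y) (fun r z)))
  ... | inj₂ (inj₂ low-r) = sliced-∈ (λ x y → m * (fun p x * fun q y))
    (∈-cartesianProduct⁺ {xs = axes} (there (there (here ≡.refl))) (∈-filter⁺ (λ p → 3 ℕ.* codeg p ℕ.≤? W) r∈ low-r))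
    (λ x y z → trans (T≈ x y z)
      (solve 4 (λ m p q r → m :* (p :* (q :* r)) := r :* (m :* (p :* q))) refl m (fun p x) (fun q y) (fun r z)))

  span-rank : ∀ {Φ W T} → Span Φ W T → SliceRank≤ (3 ℕ.* length (low W Φ)) T
  span-rank {Φ} {W} {T} t = ≡.subst (λ r → SliceRank≤ r T)
    (length-cartesianProduct axes (low W Φ)) (sliced-rank (span-sliced t))

-- The tensor of a zero pattern

-- Markov's inequality in counting form; applied to `weight` it becomes the Chernoff bound.
markov : ∀ {a p} {A : Set a} {P : A → Set p} (P? : ∀ x → Dec (P x)) (v : A → ℕ) {y} xs →
         (∀ {x} → x ∈ xs → P x → y ℕ.≤ v x) → length (filter P? xs) ℕ.* y ℕ.≤ sum (map v xs)
markov P? v []       _   = z≤n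
markov P? v (x ∷ xs) y≤v with P? x
... | yes Px = ℕ.+-mono-≤ (y≤v (here ≡.refl) Px) (markov P? v xs (y≤v ∘ there))
... | no _   = ℕ.m≤n⇒m≤o+n (v x) (markov P? v xs (y≤v ∘ there))

^-distrib-* : ∀ m n o → (m ℕ.* n) ℕ.^ o ≡ m ℕ.^ o ℕ.* n ℕ.^ o
^-distrib-* m n zero    = ≡.refl
^-distrib-* m n (suc o) = ≡.trans (≡.cong (m ℕ.* n ℕ.*_) (^-distrib-* m n o))
  (ℕ.[m*n]*[o*p]≡[m*o]*[n*p] m n (m ℕ.^ o) (n ℕ.^ o))

module Weights (s t : ℕ) (s≤t : s ℕ.≤ t) where
  open import Data.Nat.Base using (_+_; _*_; _∸_; _^_; _≤_)

  -- The ratio (s / t) ^ 3 is the parameter of the Chernoff bound; homogeneity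
  -- and the cube keep all quantities integral.
  weight : ℕ → ℕ → ℕ
  weight w d = (s ^ 3) ^ w * (t ^ 3) ^ d

  weight-* : ∀ w d w′ d′ → weight (w + w′) (d + d′) ≡ weight w d * weight w′ d′
  weight-* w d w′ d′ = ≡.trans
    (≡.cong₂ _*_ (ℕ.^-distribˡ-+-* (s ^ 3) w w′) (ℕ.^-distribˡ-+-* (t ^ 3) d d′))
    (ℕ.[m*n]*[o*p]≡[m*o]*[n*p] ((s ^ 3) ^ w) ((s ^ 3) ^ w′) ((t ^ 3) ^ d) ((t ^ 3) ^ d′))

  -- The weight per unit of w + d at the threshold 3 w = w + d, where s ^ (3 w) · t ^ (3 d) = (s · t
  -- ^ 2) ^ (w + d).
  scale : ℕ
  scale = s * (t * t)

  -- Going below the threshold exchanges W - 3 w factors `s` for factors `t`, which are at least as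
  -- large.
  scale-≤ : ∀ {W} w d → w + d ≡ W → 3 * w ≤ W → scale ^ W ≤ weight w d
  scale-≤ {W} w d ≡.refl 3w≤W = begin
    scale ^ W                               ≡⟨ ^-distrib-* s (t * t) W ⟩
    s ^ W * (t * t) ^ W                     ≡⟨ ≡.cong₂ (λ u v → s ^ u * v ^ W) (≡.sym 3w+δ≡W)
                                               (≡.cong (t *_) (≡.sym (ℕ.*-identityʳ t))) ⟩
    s ^ (3 * w + δ) * (t ^ 2) ^ W           ≡⟨ ≡.cong₂ _*_ (ℕ.^-distribˡ-+-* s (3 * w) δ) (ℕ.^-*-assoc t 2 W) ⟩
    s ^ (3 * w) * s ^ δ * t ^ (2 * W)       ≤⟨ ℕ.*-monoˡ-≤ (t ^ (2 * W))
                                               (ℕ.*-monoʳ-≤ (s ^ (3 * w)) (ℕ.^-monoˡ-≤ δ s≤t)) ⟩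
    s ^ (3 * w) * t ^ δ * t ^ (2 * W)       ≡⟨ ℕ.*-assoc (s ^ (3 * w)) (t ^ δ) (t ^ (2 * W)) ⟩
    s ^ (3 * w) * (t ^ δ * t ^ (2 * W))     ≡⟨ ≡.cong (s ^ (3 * w) *_) (ℕ.^-distribˡ-+-* t δ (2 * W)) ⟨
    s ^ (3 * w) * t ^ (δ + 2 * W)           ≡⟨ ≡.cong (λ u → s ^ (3 * w) * t ^ u) δ+2W≡3d ⟩
    s ^ (3 * w) * t ^ (3 * d)               ≡⟨ ≡.cong₂ _*_ (ℕ.^-*-assoc s 3 w) (ℕ.^-*-assoc t 3 d) ⟨
    weight w d                              ∎
    where
    open ℕ.≤-Reasoning
    open +-*-Solver
    δ = W ∸ 3 * w
    3w+δ≡W : 3 * w + δ ≡ W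
    3w+δ≡W = ℕ.m+[n∸m]≡n 3w≤W
    δ+2W≡3d : δ + 2 * W ≡ 3 * d
    δ+2W≡3d = ℕ.+-cancelˡ-≡ (3 * w) _ _ (≡.trans (≡.sym (ℕ.+-assoc (3 * w) δ (2 * W)))
      (≡.trans (≡.cong (_+ 2 * W) 3w+δ≡W)
        (solve 2 (λ w d → (w :+ d) :+ con 2 :* (w :+ d) := con 3 :* w :+ con 3 :* d) ≡.refl w d)))

module Diagonalisation {c ℓ a b} (F : CommutativeRing c ℓ) (k-1 : ℕ)
                 (isField : IsFieldOfOrder F (3 ℕ.^ suc k-1)) (DX : DecSetoid a b) where

  k : ℕ
  k = suc k-1

  open CommutativeRing F
  open Char3Field F k isField
  open Expansion F k isField DX public
  open DecSetoid DX using () renaming (Carrier to X)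
  open SemiringSolver commutativeSemiring using (solve; _:+_; _:*_; _:=_; con)

  -- Bracketed as `e` unfolds on three entries, so that `e≈e₂` has only units to remove.
  e₂ : Carrier → Carrier → Carrier → Carrier
  e₂ x y z = x * y + (x * z + y * z)

  cube-e₂ : ∀ x y z → cube (e₂ x y z) ≈ e₂ (cube x) (cube y) (cube z)
  cube-e₂ x y z = trans (cube-+ _ _) (+-cong (cube-* x y) (trans (cube-+ _ _) (+-cong (cube-* x z) (cube-* y z))))

  squareMonomials : (X → Carrier) → List Monomial
  squareMonomials f = monomial (λ _ → 1#) 2 0 ∷ monomial f 1 1 ∷ monomial (λ x → f x * f x) 0 2 ∷ []

  -- The squares in the expansion, such as x ^ 2 · y ^ 2, have codegrees 0, 0, 2, and the mixed
  -- terms, such as 2 · x ^ 2 · y · z, have codegrees 0, 1, 1.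
  span-square : ∀ f → Span (squareMonomials f) 2 (λ x y z → e₂ (f x) (f y) (f z) * e₂ (f x) (f y) (f z))
  span-square f =
    plus (plus (term 1# p₂ p₂ p₀ ℕ.≤-refl (λ _ _ _ → refl))
         (plus (term 1# p₂ p₀ p₂ ℕ.≤-refl (λ _ _ _ → refl))
               (term 1# p₀ p₂ p₂ ℕ.≤-refl (λ _ _ _ → refl)) (λ _ _ _ → refl)) (λ _ _ _ → refl))
         (plus (term (1# + 1#) p₂ p₁ p₁ ℕ.≤-refl (λ _ _ _ → refl))
         (plus (term (1# + 1#) p₁ p₂ p₁ ℕ.≤-refl (λ _ _ _ → refl))
               (term (1# + 1#) p₁ p₁ p₂ ℕ.≤-refl (λ _ _ _ → refl)) (λ _ _ _ → refl)) (λ _ _ _ → refl))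
         (λ x y z → solve 3 (λ x y z →
           (x :* y :+ (x :* z :+ y :* z)) :* (x :* y :+ (x :* z :+ y :* z)) :=
           (con 1 :* (x :* x :* (y :* y :* con 1)) :+
             (con 1 :* (x :* x :* (con 1 :* (z :* z))) :+ con 1 :* (con 1 :* (y :* y :* (z :* z))))) :+
           ((con 1 :+ con 1) :* (x :* x :* (y :* z)) :+
             ((con 1 :+ con 1) :* (x :* (y :* y :* z)) :+ (con 1 :+ con 1) :* (x :* (y :* (z :* z))))))
           refl (f x) (f y) (f z))
    where
    p₀ : monomial (λ _ → 1#) 2 0 ∈ squareMonomials f
    p₀ = here ≡.refl
    p₁ : monomial f 1 1 ∈ squareMonomials f
    p₁ = there (here ≡.refl)
    p₂ : monomial (λ x → f x * f x) 0 2 ∈ squareMonomials f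
    p₂ = there (there (here ≡.refl))

  -- The monomials of degree < 3 ^ j in f, one for each digit expansion of the
  -- exponent in base 3; deg is the digit sum, and codeg its complement to 2 j.
  powerMonomials : ℕ → (X → Carrier) → List Monomial
  powerMonomials zero    f = monomial (λ _ → 1#) 0 0 ∷ []
  powerMonomials (suc j) f = squareMonomials f ⊠ powerMonomials j (cube ∘ f)

  span-powerPred : ∀ j f → Span (powerMonomials j f) (j ℕ.* 2)
                                (λ x y z → powerPred j (e₂ (f x) (f y) (f z)))
  span-powerPred zero    f = term 1# (here ≡.refl) (here ≡.refl) (here ≡.refl) z≤n
    (λ _ _ _ → sym (trans (*-identityˡ _) (trans (*-identityˡ _) (*-identityˡ _))))
  span-powerPred (suc j) f = span-* (span-square f) (span-powerPred j (cube ∘ f))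
    (λ x y z → *-congˡ (powerPred-cong j (cube-e₂ (f x) (f y) (f z))))

  -- The constant heads `squareMonomials`, and products of lists combine the two heads first; so the
  -- monomial dropped here is the constant.
  nonconstant : ℕ → (X → Carrier) → List Monomial
  nonconstant j f = drop 1 (powerMonomials j f)

  powerMonomials-∷ : ∀ j f → ∃[ h ] (powerMonomials j f ≡ h ∷ nonconstant j f ×
                     (∀ x → fun h x ≈ 1#) × codeg h ≡ j ℕ.* 2 × deg h ≡ 0)
  powerMonomials-∷ zero    f = _ , ≡.refl , (λ _ → refl) , ≡.refl , ≡.refl
  powerMonomials-∷ (suc j) f with powerMonomials j (cube ∘ f) | powerMonomials-∷ j (cube ∘ f)
  ... | []    | _ , () , _
  ... | h ∷ _ | _ , ≡.refl , h≈1 , codeg-h , deg-h =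
    _ , ≡.refl , (λ x → trans (*-identityˡ _) (h≈1 x)) , ≡.cong (2 ℕ.+_) codeg-h , deg-h

  -- Digit 2 at every place gives the exponent 3 ^ j - 1.
  top∈powerMonomials : ∀ j f → ∃[ p ] (p ∈ powerMonomials j f × codeg p ≡ 0 ×
                       (∀ x → fun p x ≈ powerPred j (f x)))
  top∈powerMonomials zero    f = _ , here ≡.refl , ≡.refl , (λ _ → refl)
  top∈powerMonomials (suc j) f with top∈powerMonomials j (cube ∘ f)
  ... | p , p∈ , codeg-p , p≈ =
    _ , ∈-cartesianProductWith⁺ _⊗_ {xs = squareMonomials f} (there (there (here ≡.refl))) p∈ ,
    codeg-p , (λ x → *-congˡ (p≈ x))

  top∈nonconstant : ∀ f → (∀ x → ¬ (f x ≈ 0#)) →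
                    ∃[ p ] (p ∈ nonconstant k f × codeg p ≡ 0 × (∀ x → fun p x ≈ 1#))
  top∈nonconstant f f≉0 with top∈powerMonomials k f | powerMonomials-∷ k f
  ... | p , p∈ , codeg-p , p≈ | h , eq , _ , codeg-h , _ with ≡.subst (p ∈_) eq p∈
  ... | there p∈′   = p , p∈′ , codeg-p , (λ x → trans (p≈ x) (powerPred-nonzero (f≉0 x)))
  -- The head has codegree 2 k, which is positive, and so cannot be the monomial of codegree 0.
  ... | here ≡.refl with () ← ≡.trans (≡.sym codeg-p) codeg-h

  -- Where f vanishes nowhere, f ^ (q - 1) = 1 has codegree 0 and replaces the
  -- monomial 1 of maximal codegree.
  powerMonomials≼nonconstant : ∀ f → (∀ x → ¬ (f x ≈ 0#)) → powerMonomials k f ≼ nonconstant k f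
  powerMonomials≼nonconstant f f≉0 {p} p∈ with powerMonomials-∷ k f
  ... | h , eq , h≈1 , _ with ≡.subst (p ∈_) eq p∈
  ... | there p∈′   = p , p∈′ , ℕ.≤-refl , (λ _ → refl)
  ... | here ≡.refl with top∈nonconstant f f≉0
  ... | t , t∈ , codeg-t , t≈1 = t , t∈ , ≡.subst (ℕ._≤ codeg p) (≡.sym codeg-t) z≤n ,
    (λ x → trans (h≈1 x) (sym (t≈1 x)))

  -- 1 - e₂ ^ (q - 1), as -1 = 1 + 1.
  indicator : (X → Carrier) → Tensor
  indicator f x y z = 1# + (1# + 1#) * powerPred k (e₂ (f x) (f y) (f z))

  indicator-0 : ∀ f {x y z} → e₂ (f x) (f y) (f z) ≈ 0# → indicator f x y z ≈ 1#
  indicator-0 f e≈0 = trans (+-congˡ (trans (*-congˡ (powerPred-zero k-1 e≈0)) (zeroʳ _))) (+-identityʳ 1#)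

  indicator-≉0 : ∀ f {x y z} → ¬ (e₂ (f x) (f y) (f z) ≈ 0#) → indicator f x y z ≈ 0#
  indicator-≉0 f e≉0 = trans (+-congˡ (*-congˡ (powerPred-nonzero e≉0))) (x+2x≈0 1#)

  -- The summand 1 must itself avoid the constant monomial: it is written as t(x) t(y) t(z) with t =
  -- f ^ (q - 1), of joint codegree 0. The coefficient 2 of the power is realised by adding the
  -- power to itself.
  span-indicator : ∀ f → (∀ x → ¬ (f x ≈ 0#)) → Span (nonconstant k f) (k ℕ.* 2) (indicator f)
  span-indicator f f≉0 with top∈nonconstant f f≉0
  ... | t , t∈ , codeg-t , t≈1 =
    plus (term 1# t∈ t∈ t∈ (≡.subst (λ u → u ℕ.+ u ℕ.+ u ℕ.≤ k ℕ.* 2) (≡.sym codeg-t) z≤n) (λ _ _ _ → refl))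
      (plus power power (λ _ _ _ → refl))
      (λ x y z → +-cong
        (sym (trans (*-identityˡ _) (trans (*-cong (t≈1 x) (*-cong (t≈1 y) (t≈1 z)))
          (trans (*-identityˡ _) (*-identityˡ _)))))
        (solve 1 (λ v → (con 1 :+ con 1) :* v := v :+ v) refl _))
    where
    power = span-≼ (powerMonomials≼nonconstant f f≉0) (span-powerPred k f)

  productMonomials : List (X → Carrier) → List Monomial
  productMonomials []       = monomial (λ _ → 1#) 0 0 ∷ []
  productMonomials (f ∷ fs) = nonconstant k f ⊠ productMonomials fs

  productIndicator : List (X → Carrier) → Tensor
  productIndicator []       x y z = 1#
  productIndicator (f ∷ fs) x y z = indicator f x y z * productIndicator fs x y z

  productIndicator-0 : ∀ fs {x y z} → (∀ {f} → f ∈ fs → e₂ (f x) (f y) (f z) ≈ 0#) →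
                       productIndicator fs x y z ≈ 1#
  productIndicator-0 []       e≈0 = refl
  productIndicator-0 (f ∷ fs) e≈0 = trans
    (*-cong (indicator-0 f (e≈0 (here ≡.refl))) (productIndicator-0 fs (e≈0 ∘ there))) (*-identityˡ 1#)

  productIndicator-≉0 : ∀ {fs f x y z} → f ∈ fs → ¬ (e₂ (f x) (f y) (f z) ≈ 0#) →
                        productIndicator fs x y z ≈ 0#
  productIndicator-≉0 {f = f} (here ≡.refl) e≉0 = trans (*-congʳ (indicator-≉0 f e≉0)) (zeroˡ _)
  productIndicator-≉0 (there f∈) e≉0 = trans (*-congˡ (productIndicator-≉0 f∈ e≉0)) (zeroʳ _)

  span-product : ∀ fs → (∀ {f} → f ∈ fs → ∀ x → ¬ (f x ≈ 0#)) →
                 Span (productMonomials fs) (length fs ℕ.* (k ℕ.* 2)) (productIndicator fs)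
  span-product []       _   = term 1# (here ≡.refl) (here ≡.refl) (here ≡.refl) z≤n
    (λ _ _ _ → sym (trans (*-identityˡ _) (trans (*-identityˡ _) (*-identityˡ _))))
  span-product (f ∷ fs) f≉0 = span-* (span-indicator f (f≉0 (here ≡.refl)))
    (span-product fs (f≉0 ∘ there)) (λ _ _ _ → refl)

  -- Ties the two exponents of `weight` together by w + d = W, the hypothesis of `scale-≤`.
  Homogeneous : ℕ → List Monomial → Set _
  Homogeneous W Φ = ∀ {p} → p ∈ Φ → codeg p ℕ.+ deg p ≡ W

  homogeneous-⊠ : ∀ {W V Φ Ψ} → Homogeneous W Φ → Homogeneous V Ψ → Homogeneous (W ℕ.+ V) (Φ ⊠ Ψ)
  homogeneous-⊠ {Φ = Φ} {Ψ} hΦ hΨ pr∈ with ∈-cartesianProductWith⁻ _⊗_ Φ Ψ pr∈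
  ... | p , r , p∈ , r∈ , ≡.refl = ≡.trans
    (+-interchange (codeg p) (codeg r) (deg p) (deg r)) (≡.cong₂ ℕ._+_ (hΦ p∈) (hΨ r∈))

  homogeneous-power : ∀ j f → Homogeneous (j ℕ.* 2) (powerMonomials j f)
  homogeneous-power zero    f (here ≡.refl) = ≡.refl
  homogeneous-power (suc j) f = homogeneous-⊠ square (homogeneous-power j (cube ∘ f))
    where
    square : Homogeneous 2 (squareMonomials f)
    square (here ≡.refl)                 = ≡.refl
    square (there (here ≡.refl))         = ≡.refl
    square (there (there (here ≡.refl))) = ≡.refl

  homogeneous-product : ∀ fs → Homogeneous (length fs ℕ.* (k ℕ.* 2)) (productMonomials fs)
  homogeneous-product []       (here ≡.refl) = ≡.refl
  homogeneous-product (f ∷ fs) = homogeneous-⊠ nonconst (homogeneous-product fs)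
    where
    nonconst : Homogeneous (k ℕ.* 2) (nonconstant k f)
    nonconst {p} p∈ with powerMonomials-∷ k f
    ... | _ , eq , _ = homogeneous-power k f {p} (≡.subst (p ∈_) (≡.sym eq) (there p∈))

  -- Counting monomials of low codegree

  module Counting (s t : ℕ) (s≤t : s ℕ.≤ t) where
    open Weights s t s≤t

    total : List Monomial → ℕ
    total Φ = sum (map (λ p → weight (codeg p) (deg p)) Φ)

    total-++ : ∀ Φ Ψ → total (Φ ++ Ψ) ≡ total Φ ℕ.+ total Ψ
    total-++ Φ Ψ = ≡.trans (≡.cong sum (map-++ _ Φ Ψ)) (sum-++ (map _ Φ) (map _ Ψ))

    total-⊗ : ∀ p Ψ → total (map (p ⊗_) Ψ) ≡ weight (codeg p) (deg p) ℕ.* total Ψ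
    total-⊗ p []      = ≡.sym (ℕ.*-zeroʳ (weight (codeg p) (deg p)))
    total-⊗ p (r ∷ Ψ) = ≡.trans
      (≡.cong₂ ℕ._+_ (weight-* (codeg p) (deg p) (codeg r) (deg r)) (total-⊗ p Ψ))
      (≡.sym (ℕ.*-distribˡ-+ (weight (codeg p) (deg p)) _ _))

    total-⊠ : ∀ Φ Ψ → total (Φ ⊠ Ψ) ≡ total Φ ℕ.* total Ψ
    total-⊠ []      Ψ = ≡.refl
    total-⊠ (p ∷ Φ) Ψ = ≡.trans (total-++ (map (p ⊗_) Ψ) (Φ ⊠ Ψ))
      (≡.trans (≡.cong₂ ℕ._+_ (total-⊗ p Ψ) (total-⊠ Φ Ψ))
        (≡.sym (ℕ.*-distribʳ-+ (total Ψ) (weight (codeg p) (deg p)) (total Φ))))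

    -- With x = (s / t) ^ 3 this is t ^ 6 · (1 + x + x ^ 2); the final 0 matches the unfolding of
    -- `total` on `squareMonomials`.
    trinomial : ℕ
    trinomial = weight 2 0 ℕ.+ (weight 1 1 ℕ.+ (weight 0 2 ℕ.+ 0))

    total-power : ∀ j f → total (powerMonomials j f) ≡ trinomial ℕ.^ j
    total-power zero    f = ≡.refl
    total-power (suc j) f = ≡.trans (total-⊠ (squareMonomials f) (powerMonomials j (cube ∘ f)))
      (≡.cong (trinomial ℕ.*_) (total-power j (cube ∘ f)))

    -- This is t ^ (6 k) times the numerator of M. Since `scale` ^ (2 k) is t ^ (6 k) times the
    -- denominator x ^ (2 k / 3), their quotient is M.
    growth : ℕ
    growth = trinomial ℕ.^ k ℕ.∸ weight (k ℕ.* 2) 0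

    -- The truncated subtraction is exact: the weight taken away is that of the head of the full
    -- list.
    total-nonconstant : ∀ f → total (nonconstant k f) ≡ growth
    total-nonconstant f with powerMonomials-∷ k f
    ... | h , eq , _ , codeg-h , deg-h = ≡.sym (≡.trans
      (≡.cong₂ ℕ._∸_ (≡.trans (≡.sym (total-power k f)) (≡.cong total eq))
        (≡.sym (≡.cong₂ weight codeg-h deg-h)))
      (ℕ.m+n∸m≡n (weight (codeg h) (deg h)) (total (nonconstant k f))))

    total-product : ∀ fs → total (productMonomials fs) ≡ growth ℕ.^ length fs
    total-product []       = ≡.refl
    total-product (f ∷ fs) = ≡.trans (total-⊠ (nonconstant k f) (productMonomials fs))
      (≡.cong₂ ℕ._*_ (total-nonconstant f) (total-product fs))

    low-bound : ∀ W Φ → Homogeneous W Φ → length (low W Φ) ℕ.* scale ℕ.^ W ℕ.≤ total Φ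
    low-bound W Φ hom = markov (λ p → 3 ℕ.* codeg p ℕ.≤? W) _ Φ
      (λ {p} p∈ → scale-≤ (codeg p) (deg p) (hom p∈))

    product-rank : ∀ fs → (∀ {f} → f ∈ fs → ∀ x → ¬ (f x ≈ 0#)) →
                   ∃[ r ] (SliceRank≤ r (productIndicator fs) ×
                     r ℕ.* (scale ℕ.^ (k ℕ.* 2)) ℕ.^ length fs ℕ.≤ 3 ℕ.* growth ℕ.^ length fs)
    product-rank fs f≉0 = 3 ℕ.* N , span-rank (span-product fs f≉0) , (begin
      3 ℕ.* N ℕ.* (scale ℕ.^ (k ℕ.* 2)) ℕ.^ length fs   ≡⟨ ≡.cong (3 ℕ.* N ℕ.*_) (≡.trans
                                                           (ℕ.^-*-assoc scale (k ℕ.* 2) (length fs))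
                                                           (≡.cong (scale ℕ.^_) (ℕ.*-comm (k ℕ.* 2) (length fs)))) ⟩
      3 ℕ.* N ℕ.* scale ℕ.^ W                           ≡⟨ ℕ.*-assoc 3 N (scale ℕ.^ W) ⟩
      3 ℕ.* (N ℕ.* scale ℕ.^ W)                         ≤⟨ ℕ.*-monoʳ-≤ 3
                                                           (low-bound W (productMonomials fs) (homogeneous-product fs)) ⟩
      3 ℕ.* total (productMonomials fs)                 ≡⟨ ≡.cong (3 ℕ.*_) (total-product fs) ⟩
      3 ℕ.* growth ℕ.^ length fs                        ∎)
      where
      open ℕ.≤-Reasoning
      W = length fs ℕ.* (k ℕ.* 2)
      N = length (low W (productMonomials fs))

-- Zero-free sequences

⊆-pair : ∀ {a} {A : Set a} {x y : A} {xs} → x ∈ xs → y ∈ xs → x ≢ y →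
         x ∷ y ∷ [] ⊆ xs ⊎ y ∷ x ∷ [] ⊆ xs
⊆-pair (here ≡.refl) (here ≡.refl) x≢y = contradiction ≡.refl x≢y
⊆-pair (here ≡.refl) (there y∈)    _   = inj₁ (≡.refl ∷ from∈ y∈)
⊆-pair (there x∈)    (here ≡.refl) _   = inj₂ (≡.refl ∷ from∈ x∈)
⊆-pair (there x∈)    (there y∈)    x≢y with ⊆-pair x∈ y∈ x≢y
... | inj₁ xy⊆ = inj₁ (_ ∷ʳ xy⊆)
... | inj₂ yx⊆ = inj₂ (_ ∷ʳ yx⊆)

module _ {a p} {A : Set a} (P : A → A → A → Set p)
         (swap₁₂ : ∀ {x y z} → P x y z → P y x z) (swap₂₃ : ∀ {x y z} → P x y z → P x z y) where

  -- Three distinct entries form a sublist in one of six orders, and the two transpositions carry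
  -- `P` back from any of them.
  ⊆-triple : ∀ {xs} → (∀ {x y z} → x ∷ y ∷ z ∷ [] ⊆ xs → P x y z) →
             ∀ {x y z} → x ∈ xs → y ∈ xs → z ∈ xs → x ≢ y → y ≢ z → x ≢ z → P x y z
  ⊆-triple h (here ≡.refl) (here ≡.refl) _ x≢y _ _ = contradiction ≡.refl x≢y
  ⊆-triple h (here ≡.refl) (there _) (here ≡.refl) _ _ x≢z = contradiction ≡.refl x≢z
  ⊆-triple h (there _) (here ≡.refl) (here ≡.refl) _ y≢z _ = contradiction ≡.refl y≢z
  ⊆-triple h (here ≡.refl) (there y∈) (there z∈) x≢y y≢z x≢z with ⊆-pair y∈ z∈ y≢z
  ... | inj₁ yz⊆ = h (≡.refl ∷ yz⊆)
  ... | inj₂ zy⊆ = swap₂₃ (h (≡.refl ∷ zy⊆))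
  ⊆-triple h (there x∈) (here ≡.refl) (there z∈) x≢y y≢z x≢z with ⊆-pair x∈ z∈ x≢z
  ... | inj₁ xz⊆ = swap₁₂ (h (≡.refl ∷ xz⊆))
  ... | inj₂ zx⊆ = swap₁₂ (swap₂₃ (h (≡.refl ∷ zx⊆)))
  ⊆-triple h (there x∈) (there y∈) (here ≡.refl) x≢y y≢z x≢z with ⊆-pair x∈ y∈ x≢y
  ... | inj₁ xy⊆ = swap₂₃ (swap₁₂ (h (≡.refl ∷ xy⊆)))
  ... | inj₂ yx⊆ = swap₂₃ (swap₁₂ (swap₂₃ (h (≡.refl ∷ yx⊆))))
  ⊆-triple h (there x∈) (there y∈) (there z∈) = ⊆-triple (λ r → h (_ ∷ʳ r)) x∈ y∈ z∈

-- Decidable search for subsequences and least numbers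

any-sublist? : ∀ {a p} {A : Set a} {P : List A → Set p} → Decidable₁ P → ∀ m xs →
               Dec (∃[ ys ] (ys ⊆ xs × length ys ≡ m × P ys))
any-sublist? P? zero xs = map′ (λ p → [] , minimum xs , ≡.refl , p) (λ { ([] , _ , _ , p) → p }) (P? [])
any-sublist? P? (suc m) [] = no λ { ([] , _ , () , _) }
any-sublist? P? (suc m) (x ∷ xs) = map′
  [ (λ (ys , ys⊆ , len , p) → x ∷ ys , ≡.refl ∷ ys⊆ , ≡.cong suc len , p)
  , (λ (ys , ys⊆ , len , p) → ys , x ∷ʳ ys⊆ , len , p) ]′
  (λ { (y ∷ ys , ≡.refl ∷ ys⊆ , len , p) → inj₁ (ys , ys⊆ , ℕ.suc-injective len , p)
     ; (ys , _ ∷ʳ ys⊆ , len , p) → inj₂ (ys , ys⊆ , len , p) })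
  (any-sublist? (P? ∘ (x ∷_)) m xs ⊎-dec any-sublist? P? (suc m) xs)

⊆-pointwise : ∀ {a r} {A : Set a} {R : A → A → Set r} {xs ys zs} → xs ⊆ ys → Pointwise R ys zs →
              ∃[ ws ] (ws ⊆ zs × Pointwise R xs ws)
⊆-pointwise []              []       = [] , [] , []
⊆-pointwise (_ ∷ʳ xs⊆)      (_ ∷ rs) with ⊆-pointwise xs⊆ rs
... | ws , ws⊆ , qs = ws , _ ∷ʳ ws⊆ , qs
⊆-pointwise (≡.refl ∷ xs⊆) (r ∷ rs) with ⊆-pointwise xs⊆ rs
... | ws , ws⊆ , qs = _ ∷ ws , ≡.refl ∷ ws⊆ , r ∷ qs

module _ {p} {P : ℕ → Set p} (P? : Decidable₁ P) where

  private
    Least : ℕ → Set p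
    Least l = 0 ℕ.< l × P l × (∀ {l′} → 0 ℕ.< l′ → P l′ → l ℕ.≤ l′)

    search : ∀ n → ∃[ l ] (l ℕ.≤ n × Least l) ⊎ (∀ {l} → 0 ℕ.< l → l ℕ.≤ n → ¬ P l)
    search zero = inj₂ λ 0<l l≤0 → contradiction l≤0 (ℕ.<⇒≱ 0<l)
    search (suc n) with search n | P? (suc n)
    ... | inj₁ (l , l≤n , least) | _     = inj₁ (l , ℕ.m≤n⇒m≤1+n l≤n , least)
    ... | inj₂ none              | yes p = inj₁ (suc n , ℕ.≤-refl , s≤s z≤n , p ,
      λ 0<l′ p′ → ℕ.≮⇒≥ λ l′<1+n → none 0<l′ (ℕ.≤-pred l′<1+n) p′)
    ... | inj₂ none              | no ¬p = inj₂ λ 0<l l≤1+n p →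
      [ (λ l<1+n → none 0<l (ℕ.≤-pred l<1+n) p) , (λ { ≡.refl → ¬p p }) ]′ (ℕ.m≤n⇒m<n∨m≡n l≤1+n)

  least-positive : ∀ {n} → 0 ℕ.< n → P n → ∃[ l ] (l ℕ.≤ n × 0 ℕ.< l × P l × (∀ {l′} → 0 ℕ.< l′ → P l′ → l ℕ.≤ l′))
  least-positive {n} 0<n p with search n
  ... | inj₁ least = least
  ... | inj₂ none  = contradiction p (none 0<n ℕ.≤-refl)

vecDecSetoid : ∀ {c ℓ} → DecSetoid c ℓ → ℕ → DecSetoid c ℓ
vecDecSetoid D n = record
  { Carrier = Fin n → Carrier
  ; _≈_ = λ x y → ∀ i → x i ≈ y i
  ; isDecEquivalence = record
    { isEquivalence = record
      { refl = λ _ → refl ; sym = λ eq i → sym (eq i) ; trans = λ p q i → trans (p i) (q i) }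
    ; _≟_ = λ x y → allFin? (λ i → x i ≟ y i) } }
  where open DecSetoid D

-- The length of zero-free sequences

module Proof {c ℓ} (F : CommutativeRing c ℓ) (k-1 : ℕ) (isField : IsFieldOfOrder F (3 ℕ.^ suc k-1)) (n : ℕ) where

  open CommutativeRing F
  open Char3Field F (suc k-1) isField
  open SemiringSolver commutativeSemiring using (solve; _:+_; _:*_; _:=_; con)

  decSetoid : DecSetoid c ℓ
  decSetoid = record { isDecEquivalence = record { isEquivalence = isEquivalence ; _≟_ = _≟_ } }

  V : Set c
  V = Fin n → Carrier

  open DecSetoid (vecDecSetoid decSetoid n) using ()
    renaming (_≈_ to _~_; _≟_ to _~?_; refl to ~-refl; sym to ~-sym; trans to ~-trans)
  open Diagonalisation F k-1 isField (vecDecSetoid decSetoid n)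

  Zero : V → V → V → Set ℓ
  Zero x y z = ∀ i → e₂ (x i) (y i) (z i) ≈ 0#

  ZeroFree : List V → Set (c ⊔ ℓ)
  ZeroFree S = ∀ {x y z} → x ∷ y ∷ z ∷ [] ⊆ S → ¬ Zero x y z

  e₂-cong : ∀ {x y z x′ y′ z′} → x ≈ x′ → y ≈ y′ → z ≈ z′ → e₂ x y z ≈ e₂ x′ y′ z′
  e₂-cong p q r = +-cong (*-cong p q) (+-cong (*-cong p r) (*-cong q r))

  e₂-swap₁₂ : ∀ x y z → e₂ y x z ≈ e₂ x y z
  e₂-swap₁₂ = solve 3 (λ x y z → y :* x :+ (y :* z :+ x :* z) := x :* y :+ (x :* z :+ y :* z)) refl

  e₂-swap₂₃ : ∀ x y z → e₂ x z y ≈ e₂ x y z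
  e₂-swap₂₃ = solve 3 (λ x y z → x :* z :+ (x :* y :+ z :* y) := x :* y :+ (x :* z :+ y :* z)) refl

  Zero-swap₁₂ : ∀ {x y z} → Zero x y z → Zero y x z
  Zero-swap₁₂ e≈0 i = trans (e₂-swap₁₂ _ _ _) (e≈0 i)

  Zero-swap₂₃ : ∀ {x y z} → Zero x y z → Zero x z y
  Zero-swap₂₃ e≈0 i = trans (e₂-swap₂₃ _ _ _) (e≈0 i)

  e₂-diagonal : ∀ x → e₂ x x x ≈ 0#
  e₂-diagonal x = trans
    (solve 1 (λ x → x :* x :+ (x :* x :+ x :* x) := (con 1 :+ (con 1 :+ con 1)) :* (x :* x)) refl x)
    (trans (*-congʳ 3≈0) (zeroˡ _))

  -- Here e₂(x, x, z) = x (x + 2 z), the factor x cancels, and 2 = -1.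
  e₂-double : ∀ {x z} → ¬ (x ≈ 0#) → e₂ x x z ≈ 0# → x ≈ z
  e₂-double {x} {z} x≉0 e≈0 = begin
    x                          ≈⟨ +-identityʳ x ⟨
    x + 0#                     ≈⟨ +-congˡ (x+2x≈0 z) ⟨
    x + (z + (1# + 1#) * z)    ≈⟨ solve 2 (λ x z → x :+ (z :+ (con 1 :+ con 1) :* z) :=
                                                (x :+ (con 1 :+ con 1) :* z) :+ z) refl x z ⟩
    x + (1# + 1#) * z + z      ≈⟨ +-congʳ x+2z≈0 ⟩
    0# + z                     ≈⟨ +-identityˡ z ⟩
    z                          ∎
    where
    open SetoidReasoning setoid
    x+2z≈0 : x + (1# + 1#) * z ≈ 0#
    x+2z≈0 = *-cancelˡ-≉0 x≉0 (trans
      (solve 2 (λ x z → x :* (x :+ (con 1 :+ con 1) :* z) := x :* x :+ (x :* z :+ x :* z)) refl x z)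
      (trans e≈0 (sym (zeroʳ x))))

  zeroFree-noTriple : ∀ {S} → ZeroFree S → NoTriple S
  zeroFree-noTriple zeroFree xyz⊆ (x~y , y~z) = zeroFree xyz⊆ λ i →
    trans (e₂-cong refl (sym (x~y i)) (sym (trans (x~y i) (y~z i)))) (e₂-diagonal _)

  module Pattern {S : List V} (zeroFree : ZeroFree S) (nz : List (Fin n))
                 (nz-≉0 : ∀ {i} → i ∈ nz → ∀ {x} → x ∈ S → ¬ (x i ≈ 0#))
                 (rest-≈0 : ∀ i → i ∈ nz ⊎ (∀ {x} → x ∈ S → x i ≈ 0#)) where

    -- Agrees with the i-th coordinate on S, but vanishes nowhere on V.
    coordinate : Fin n → V → Carrier
    coordinate i x = unitize (x i)

    coordinates : List (V → Carrier)
    coordinates = map coordinate nz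

    -- Expansions are identities on all of `V`, not just on `S`, so nonvanishing is required
    -- everywhere.
    coordinates≉0 : ∀ {f} → f ∈ coordinates → ∀ x → ¬ (f x ≈ 0#)
    coordinates≉0 f∈ x with ∈-map⁻ coordinate f∈
    ... | i , _ , ≡.refl = unitize≉0 (x i)

    coordinate≈ : ∀ {i} → i ∈ nz → ∀ {x} → x ∈ S → coordinate i x ≈ x i
    coordinate≈ i∈ x∈ = unitize-nonzero (nz-≉0 i∈ x∈)

    Zero-double : ∀ {x z} → x ∈ S → z ∈ S → Zero x x z → x ~ z
    Zero-double x∈ z∈ e≈0 i with rest-≈0 i
    ... | inj₁ i∈  = e₂-double (nz-≉0 i∈ x∈) (e≈0 i)
    ... | inj₂ i≈0 = trans (i≈0 x∈) (sym (i≈0 z∈))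

    -- If two of the vectors agree, `Zero-double` yields the third; if no two agree, they sit at
    -- distinct positions and contradict zero-freeness.
    Zero⇒equal : ∀ {x y z} → x ∈ S → y ∈ S → z ∈ S → Zero x y z → x ~ y × y ~ z
    Zero⇒equal {x} {y} {z} x∈ y∈ z∈ e≈0 with x ~? y | y ~? z | x ~? z
    ... | yes x~y | _ | _ = x~y , ~-trans (~-sym x~y)
      (Zero-double x∈ z∈ λ i → trans (e₂-cong refl (x~y i) refl) (e≈0 i))
    ... | no _ | yes y~z | _ = ~-sym (Zero-double y∈ x∈ λ i →
      trans (e₂-cong refl (y~z i) refl) (Zero-swap₂₃ (Zero-swap₁₂ e≈0) i)) , y~z
    ... | no x≁y | no y≁z | yes x~z = contradiction (Zero-double x∈ y∈ λ i →
      trans (e₂-cong refl (x~z i) refl) (Zero-swap₂₃ e≈0 i)) x≁y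
    ... | no x≁y | no y≁z | no x≁z = contradiction e≈0
      (⊆-triple (λ x y z → ¬ Zero x y z) (_∘ Zero-swap₁₂) (_∘ Zero-swap₂₃) zeroFree x∈ y∈ z∈
        (λ { ≡.refl → x≁y ~-refl }) (λ { ≡.refl → y≁z ~-refl }) (λ { ≡.refl → x≁z ~-refl }))

    diagonal : Diagonal (productIndicator coordinates) S
    diagonal .Diagonal.on x∈ T≈0 = 1≉0 (trans (sym (productIndicator-0 coordinates (λ _ → e₂-diagonal _))) T≈0)
    diagonal .Diagonal.off {x} {y} {z} x∈ y∈ z∈ ≁ =
      decidable-stable (productIndicator coordinates x y z ≟ 0#) λ T≉0 → ≁ (Zero⇒equal x∈ y∈ z∈ (e≈0 T≉0))
      where
      e≈0 : ¬ (productIndicator coordinates x y z ≈ 0#) → Zero x y z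
      e≈0 T≉0 i with rest-≈0 i
      ... | inj₁ i∈  = trans (sym (e₂-cong (coordinate≈ i∈ x∈) (coordinate≈ i∈ y∈) (coordinate≈ i∈ z∈)))
        (decidable-stable (_ ≟ 0#) λ e≉0 → T≉0 (productIndicator-≉0 (∈-map⁺ coordinate i∈) e≉0))
      ... | inj₂ i≈0 = trans (e₂-cong (i≈0 x∈) (i≈0 y∈) (i≈0 z∈)) (e₂-diagonal 0#)

  module Bounds (s t : ℕ) (s≤t : s ℕ.≤ t) where
    open Weights s t s≤t
    open Counting s t s≤t

    Q : ℕ
    Q = scale ℕ.^ (k ℕ.* 2)

    -- The constant 6 is 2 positions per class of equal vectors times 3 axes.
    pattern-bound : ∀ {S} → ZeroFree S → ∀ nz →
                    (∀ {i} → i ∈ nz → ∀ {x} → x ∈ S → ¬ (x i ≈ 0#)) →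
                    (∀ i → i ∈ nz ⊎ (∀ {x} → x ∈ S → x i ≈ 0#)) →
                    length S ℕ.* Q ℕ.^ length nz ℕ.≤ 6 ℕ.* growth ℕ.^ length nz
    pattern-bound {S} zeroFree nz nz-≉0 pat with product-rank coordinates coordinates≉0
      where open Pattern zeroFree nz nz-≉0 pat
    ... | r , rank , r*Q≤ rewrite length-map (Pattern.coordinate zeroFree nz nz-≉0 pat) nz = begin
      length S ℕ.* Q ℕ.^ m      ≤⟨ ℕ.*-monoˡ-≤ (Q ℕ.^ m)
                                     (sliceRank-bound r rank diagonal (zeroFree-noTriple zeroFree)) ⟩
      r ℕ.* 2 ℕ.* Q ℕ.^ m       ≡⟨ S.solve 2 (λ r q → r S.:* S.con 2 S.:* q S.:= S.con 2 S.:* (r S.:* q))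
                                     ≡.refl r (Q ℕ.^ m) ⟩
      2 ℕ.* (r ℕ.* Q ℕ.^ m)     ≤⟨ ℕ.*-monoʳ-≤ 2 r*Q≤ ⟩
      2 ℕ.* (3 ℕ.* growth ℕ.^ m) ≡⟨ ℕ.*-assoc 2 3 (growth ℕ.^ m) ⟨
      6 ℕ.* growth ℕ.^ m        ∎
      where
      open Pattern zeroFree nz nz-≉0 pat
      open ℕ.≤-Reasoning
      module S = +-*-Solver
      m = length nz

    -- Splitting by the vanishing of each coordinate yields
    -- Σ_m (n choose m) (growth / Q) ^ m = (1 + growth / Q) ^ n.
    split-bound : ∀ {S} → ZeroFree S → ∀ nz rest →
                  (∀ {i} → i ∈ nz → ∀ {x} → x ∈ S → ¬ (x i ≈ 0#)) →
                  (∀ i → i ∈ rest ⊎ i ∈ nz ⊎ (∀ {x} → x ∈ S → x i ≈ 0#)) →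
                  length S ℕ.* Q ℕ.^ (length rest ℕ.+ length nz) ℕ.≤
                  6 ℕ.* growth ℕ.^ length nz ℕ.* (growth ℕ.+ Q) ℕ.^ length rest
    split-bound {S} zeroFree nz [] nz-≉0 pat = ℕ.≤-trans
      (pattern-bound zeroFree nz nz-≉0 (λ i → [ (λ ()) , (λ p → p) ]′ (pat i)))
      (ℕ.≤-reflexive (≡.sym (ℕ.*-identityʳ _)))
    split-bound {S} zeroFree nz (i ∷ rest) nz-≉0 pat = begin
      length S ℕ.* (Q ℕ.* Q^)
        ≡⟨ ≡.cong (ℕ._* (Q ℕ.* Q^)) (length-filter-¬ zero? S) ⟩
      (length S₀ ℕ.+ length S₁) ℕ.* (Q ℕ.* Q^)
        ≡⟨ N.solve 4 (λ u v q p → (u N.:+ v) N.:* (q N.:* p) N.:= q N.:* (u N.:* p) N.:+ v N.:* (q N.:* p))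
             ≡.refl (length S₀) (length S₁) Q Q^ ⟩
      Q ℕ.* (length S₀ ℕ.* Q^) ℕ.+ length S₁ ℕ.* (Q ℕ.* Q^)
        ≡⟨ ≡.cong (λ j → Q ℕ.* (length S₀ ℕ.* Q^) ℕ.+ length S₁ ℕ.* Q ℕ.^ j) (ℕ.+-suc (length rest) (length nz)) ⟨
      Q ℕ.* (length S₀ ℕ.* Q^) ℕ.+ length S₁ ℕ.* Q ℕ.^ (length rest ℕ.+ suc (length nz))
        ≤⟨ ℕ.+-mono-≤
             (ℕ.*-monoʳ-≤ Q (split-bound (λ r → zeroFree (⊆-trans r (filter-⊆ zero? S))) nz rest
               (λ j∈ x∈ → nz-≉0 j∈ (S₀⊆S x∈)) pat₀))
             (split-bound (λ r → zeroFree (⊆-trans r (filter-⊆ (¬? ∘ zero?) S))) (i ∷ nz) rest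
               nz-≉0₁ pat₁) ⟩
      Q ℕ.* (6 ℕ.* g^ ℕ.* h^) ℕ.+ 6 ℕ.* (growth ℕ.* g^) ℕ.* h^
        ≡⟨ N.solve 4 (λ q g p h → q N.:* (N.con 6 N.:* p N.:* h) N.:+ N.con 6 N.:* (g N.:* p) N.:* h N.:=
                                  N.con 6 N.:* p N.:* ((g N.:+ q) N.:* h)) ≡.refl Q growth g^ h^ ⟩
      6 ℕ.* g^ ℕ.* ((growth ℕ.+ Q) ℕ.* h^) ∎
      where
      open ℕ.≤-Reasoning
      module N = +-*-Solver
      Q^ = Q ℕ.^ (length rest ℕ.+ length nz)
      g^ = growth ℕ.^ length nz
      h^ = (growth ℕ.+ Q) ℕ.^ length rest
      zero? : Decidable₁ (λ (x : V) → x i ≈ 0#)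
      zero? x = x i ≟ 0#
      S₀ = filter zero? S
      S₁ = filter (¬? ∘ zero?) S
      S₀⊆S : ∀ {x} → x ∈ S₀ → x ∈ S
      S₀⊆S x∈ = proj₁ (∈-filter⁻ zero? x∈)
      S₁⊆S : ∀ {x} → x ∈ S₁ → x ∈ S
      S₁⊆S x∈ = proj₁ (∈-filter⁻ (¬? ∘ zero?) x∈)
      nz-≉0₁ : ∀ {j} → j ∈ i ∷ nz → ∀ {x} → x ∈ S₁ → ¬ (x j ≈ 0#)
      nz-≉0₁ (here ≡.refl) x∈ = proj₂ (∈-filter⁻ (¬? ∘ zero?) {xs = S} x∈)
      nz-≉0₁ (there j∈)    x∈ = nz-≉0 j∈ (S₁⊆S x∈)
      pat₀ : ∀ j → j ∈ rest ⊎ j ∈ nz ⊎ (∀ {x} → x ∈ S₀ → x j ≈ 0#)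
      pat₀ j with pat j
      ... | inj₁ (here ≡.refl) = inj₂ (inj₂ λ x∈ → proj₂ (∈-filter⁻ zero? {xs = S} x∈))
      ... | inj₁ (there j∈)    = inj₁ j∈
      ... | inj₂ (inj₁ j∈)     = inj₂ (inj₁ j∈)
      ... | inj₂ (inj₂ j≈0)    = inj₂ (inj₂ (j≈0 ∘ S₀⊆S))
      pat₁ : ∀ j → j ∈ rest ⊎ j ∈ i ∷ nz ⊎ (∀ {x} → x ∈ S₁ → x j ≈ 0#)
      pat₁ j with pat j
      ... | inj₁ (here ≡.refl) = inj₂ (inj₁ (here ≡.refl))
      ... | inj₁ (there j∈)    = inj₁ j∈
      ... | inj₂ (inj₁ j∈)     = inj₂ (inj₁ (there j∈))
      ... | inj₂ (inj₂ j≈0)    = inj₂ (inj₂ (j≈0 ∘ S₁⊆S))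

    zeroFree-bound : ∀ {S} → ZeroFree S → length S ℕ.* Q ℕ.^ n ℕ.≤ 6 ℕ.* (growth ℕ.+ Q) ℕ.^ n
    zeroFree-bound {S} zeroFree = ≡.subst₂
      (λ u v → length S ℕ.* Q ℕ.^ u ℕ.≤ 6 ℕ.* (growth ℕ.+ Q) ℕ.^ v)
      (≡.trans (ℕ.+-identityʳ _) (length-tabulate {n = n} (λ i → i))) (length-tabulate {n = n} (λ i → i))
      (split-bound zeroFree [] (allFin n) (λ ()) (λ i → inj₁ (∈-allFin i)))

-- Rational powers and the minimal length

open RawSemiringDefinitions ℚ.+-*-rawSemiring using () renaming (_^_ to _^ℚ_)

/-* : ∀ a b m n .{{_ : ℕ.NonZero m}} .{{_ : ℕ.NonZero n}} .{{_ : ℕ.NonZero (m ℕ.* n)}} →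
      (+ a ℚᵘ./ m) ℚᵘ.* (+ b ℚᵘ./ n) ℚᵘ.≃ + (a ℕ.* b) ℚᵘ./ (m ℕ.* n)
/-* a b (suc m) (suc n) = ℚᵘ.≃-reflexive (≡.cong (λ i → mkℚᵘ i _) (≡.sym (ℤ.pos-* a b)))

-- Unnormalised fractions keep the powers of numerator and denominator literally, where normalised
-- ones would be reduced.
/-^ : ∀ C D .{{_ : ℕ.NonZero D}} m .{{_ : ℕ.NonZero (D ℕ.^ m)}} →
      ℚ.toℚᵘ ((+ C ℚ./ D) ^ℚ m) ℚᵘ.≃ + (C ℕ.^ m) ℚᵘ./ (D ℕ.^ m)
/-^ C D zero    = ℚᵘ.≃-refl
/-^ C D@(suc _) (suc m) = begin
  ℚ.toℚᵘ ((+ C ℚ./ D) ℚ.* (+ C ℚ./ D) ^ℚ m)            ≈⟨ ℚ.toℚᵘ-homo-* (+ C ℚ./ D) _ ⟩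
  ℚ.toℚᵘ (+ C ℚ./ D) ℚᵘ.* ℚ.toℚᵘ ((+ C ℚ./ D) ^ℚ m)   ≈⟨ ℚᵘ.*-cong (ℚ.toℚᵘ-fromℚᵘ (+ C ℚᵘ./ D)) (/-^ C D m) ⟩
  (+ C ℚᵘ./ D) ℚᵘ.* (+ (C ℕ.^ m) ℚᵘ./ (D ℕ.^ m))        ≈⟨ /-* C (C ℕ.^ m) D (D ℕ.^ m) ⟩
  + (C ℕ.^ suc m) ℚᵘ./ (D ℕ.^ suc m)                    ∎
  where
  open import Relation.Binary.Reasoning.Setoid ℚᵘ.≃-setoid
  instance
    D^m≢0 : ℕ.NonZero (D ℕ.^ m)
    D^m≢0 = ℕ.m^n≢0 D m

≤-/^ : ∀ l C D .{{_ : ℕ.NonZero D}} m → l ℕ.* D ℕ.^ m ℕ.≤ C ℕ.^ m →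
       (+ l ℚ./ 1) ℚ.≤ (+ C ℚ./ D) ^ℚ m
≤-/^ l C D@(suc _) m l*D^m≤C^m = ℚ.toℚᵘ-cancel-≤ (begin
  ℚ.toℚᵘ (+ l ℚ./ 1)              ≃⟨ ℚ.toℚᵘ-fromℚᵘ (+ l ℚᵘ./ 1) ⟩
  + l ℚᵘ./ 1                      ≤⟨ ≤-/ (C ℕ.^ m) (D ℕ.^ m) l*D^m≤C^m ⟩
  + (C ℕ.^ m) ℚᵘ./ (D ℕ.^ m)      ≃⟨ /-^ C D m ⟨
  ℚ.toℚᵘ ((+ C ℚ./ D) ^ℚ m)       ∎)
  where
  open ℚᵘ.≤-Reasoning
  instance
    D^m≢0 : ℕ.NonZero (D ℕ.^ m)
    D^m≢0 = ℕ.m^n≢0 D m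
  ≤-/ : ∀ c d .{{_ : ℕ.NonZero d}} → l ℕ.* d ℕ.≤ c → + l ℚᵘ./ 1 ℚᵘ.≤ + c ℚᵘ./ d
  ≤-/ c (suc d) le = *≤* (≡.subst₂ ℤ._≤_ (ℤ.pos-* l (suc d)) (≡.sym (ℤ.*-identityʳ (+ c))) (ℤ.+≤+ le))

-- Existence and size of the EGZ constant

module EGZ {c ℓ} (F : CommutativeRing c ℓ) (k-1 : ℕ) (isField : IsFieldOfOrder F (3 ℕ.^ suc k-1)) (n : ℕ) where

  open CommutativeRing F
  open Char3Field F (suc k-1) isField
  open Proof F k-1 isField n
  open Diagonalisation F k-1 isField (vecDecSetoid decSetoid n) using (e₂; module Counting)
  open DecSetoid (vecDecSetoid decSetoid n) using ()
    renaming (_≈_ to _~_; _≟_ to _~?_; refl to ~-refl; sym to ~-sym; trans to ~-trans)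

  HasZero : List V → Set _
  HasZero S = ∃[ S′ ] (S′ ⊆ S × length S′ ≡ 3 × e (Power F n) 2 S′ ~ (λ _ → 0#))

  HasZero? : ∀ S → Dec (HasZero S)
  HasZero? = any-sublist? (λ S′ → e (Power F n) 2 S′ ~? (λ _ → 0#)) 3

  e≈e₂ : ∀ x y z i → e (Power F n) 2 (x ∷ y ∷ z ∷ []) i ≈ e₂ (x i) (y i) (z i)
  e≈e₂ x y z i = +-cong (*-congˡ (*-identityʳ _))
    (+-cong (*-congˡ (*-identityʳ _)) (trans (+-identityʳ _) (*-congˡ (*-identityʳ _))))

  ¬HasZero⇒ZeroFree : ∀ {S} → ¬ HasZero S → ZeroFree S
  ¬HasZero⇒ZeroFree ¬zero {x} {y} {z} xyz⊆ e≈0 =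
    ¬zero (_ , xyz⊆ , ≡.refl , λ i → trans (e≈e₂ x y z i) (e≈0 i))

  HasZero-⊆ : ∀ {S T} → S ⊆ T → HasZero S → HasZero T
  HasZero-⊆ S⊆T (S′ , S′⊆S , rest) = S′ , ⊆-trans S′⊆S S⊆T , rest

  HasZero-resp : ∀ {S T} → Pointwise _~_ S T → HasZero S → HasZero T
  HasZero-resp S~T (x ∷ y ∷ z ∷ [] , xyz⊆ , _ , e≈0) with ⊆-pointwise xyz⊆ S~T
  ... | x′ ∷ y′ ∷ z′ ∷ [] , ⊆T , x~ ∷ y~ ∷ z~ ∷ [] = _ , ⊆T , ≡.refl , λ i →
    trans (e≈e₂ x′ y′ z′ i) (trans (e₂-cong (sym (x~ i)) (sym (y~ i)) (sym (z~ i)))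
      (trans (sym (e≈e₂ x y z i)) (e≈0 i)))

  functions : ∀ m → List (Fin m → Carrier)
  functions zero    = (λ ()) ∷ []
  functions (suc m) = cartesianProductWith Vec._∷_ elements (functions m)

  functions-complete : ∀ {m} (x : Fin m → Carrier) → ∃[ y ] (y ∈ functions m × (∀ i → x i ≈ y i))
  functions-complete {zero}  x = _ , here ≡.refl , λ ()
  functions-complete {suc m} x with elements-complete (x Fin.zero) | functions-complete (x ∘ Fin.suc)
  ... | a , a∈ , x₀≈a | y , y∈ , x≈y = a Vec.∷ y , ∈-cartesianProductWith⁺ Vec._∷_ a∈ y∈ ,
    λ { Fin.zero → x₀≈a ; (Fin.suc i) → x≈y i }

  lists : ℕ → List (List V)
  lists zero    = [] ∷ []
  lists (suc l) = cartesianProductWith _∷_ (functions n) (lists l)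

  lists-length : ∀ l {S} → S ∈ lists l → length S ≡ l
  lists-length zero    (here ≡.refl) = ≡.refl
  lists-length (suc l) S∈ with ∈-cartesianProductWith⁻ _∷_ (functions n) (lists l) S∈
  ... | _ , _ , _ , S∈′ , ≡.refl = ≡.cong suc (lists-length l S∈′)

  lists-complete : ∀ S → ∃[ T ] (T ∈ lists (length S) × Pointwise _~_ S T)
  lists-complete []      = [] , here ≡.refl , []
  lists-complete (x ∷ S) with functions-complete x | lists-complete S
  ... | y , y∈ , x~y | T , T∈ , S~T = y ∷ T , ∈-cartesianProductWith⁺ _∷_ y∈ T∈ , x~y ∷ S~T

  -- Needed to find the least length by search. Finitely many tests suffice: a long sequence is cut
  -- to length `l` and its entries are replaced by enumerated representatives, and a zero found
  -- there is also one of the original sequence.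
  HasEGZProperty? : ∀ l → Dec (HasEGZProperty 3 (Power F n) 2 l)
  HasEGZProperty? l = map′ fromAll toAll (All.all? HasZero? (lists l))
    where
    fromAll : All HasZero (lists l) → HasEGZProperty 3 (Power F n) 2 l
    fromAll all S |S|≥l with lists-complete (take l S)
    ... | T , T∈ , S~T = HasZero-⊆ (take-⊆ l S)
      (HasZero-resp (Pointwise.symmetric ~-sym S~T)
        (All.lookup all (≡.subst (λ j → T ∈ lists j) (≡.trans (length-take l S) (ℕ.m≤n⇒m⊓n≡m |S|≥l)) T∈)))
    toAll : HasEGZProperty 3 (Power F n) 2 l → All HasZero (lists l)
    toAll has = All.tabulate λ T∈ → has _ (ℕ.≤-reflexive (≡.sym (lists-length l T∈)))

  module _ (s t C : ℕ) (s≤t : s ℕ.≤ t) (C≥7000 : 7000 ℕ.≤ C) where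
    open Bounds s t s≤t
    open Counting s t s≤t using (growth)

    module _ .{{_ : ℕ.NonZero Q}} (rate : (growth ℕ.+ Q) ℕ.* 1000 ℕ.≤ C ℕ.* Q) where

      private
        instance
          1000^n≢0 : ℕ.NonZero (1000 ℕ.^ n)
          1000^n≢0 = ℕ.m^n≢0 1000 n
          Q^n≢0 : ℕ.NonZero (Q ℕ.^ n)
          Q^n≢0 = ℕ.m^n≢0 Q n

      zeroFree-length : ∀ {S} → ZeroFree S → length S ℕ.* 1000 ℕ.^ n ℕ.≤ 6 ℕ.* C ℕ.^ n
      zeroFree-length {S} zeroFree = ℕ.*-cancelʳ-≤ _ _ (Q ℕ.^ n) (begin
        length S ℕ.* 1000 ℕ.^ n ℕ.* Q ℕ.^ n            ≡⟨ N.solve 3 (λ u v w → u N.:* v N.:* w N.:= u N.:* w N.:* v)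
                                                            ≡.refl (length S) (1000 ℕ.^ n) (Q ℕ.^ n) ⟩
        length S ℕ.* Q ℕ.^ n ℕ.* 1000 ℕ.^ n            ≤⟨ ℕ.*-monoˡ-≤ (1000 ℕ.^ n) (zeroFree-bound zeroFree) ⟩
        6 ℕ.* (growth ℕ.+ Q) ℕ.^ n ℕ.* 1000 ℕ.^ n      ≡⟨ ℕ.*-assoc 6 ((growth ℕ.+ Q) ℕ.^ n) (1000 ℕ.^ n) ⟩
        6 ℕ.* ((growth ℕ.+ Q) ℕ.^ n ℕ.* 1000 ℕ.^ n)    ≡⟨ ≡.cong (6 ℕ.*_) (^-distrib-* (growth ℕ.+ Q) 1000 n) ⟨
        6 ℕ.* ((growth ℕ.+ Q) ℕ.* 1000) ℕ.^ n          ≤⟨ ℕ.*-monoʳ-≤ 6 (ℕ.^-monoˡ-≤ n rate) ⟩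
        6 ℕ.* (C ℕ.* Q) ℕ.^ n                          ≡⟨ ≡.cong (6 ℕ.*_) (^-distrib-* C Q n) ⟩
        6 ℕ.* (C ℕ.^ n ℕ.* Q ℕ.^ n)                    ≡⟨ ℕ.*-assoc 6 (C ℕ.^ n) (Q ℕ.^ n) ⟨
        6 ℕ.* C ℕ.^ n ℕ.* Q ℕ.^ n                      ∎)
        where
        open ℕ.≤-Reasoning
        module N = +-*-Solver

      private
        l₀ : ℕ
        -- One more than the largest length that `zeroFree-length` permits.
        l₀ = suc (6 ℕ.* C ℕ.^ n ℕ./ 1000 ℕ.^ n)

      l₀-property : HasEGZProperty 3 (Power F n) 2 l₀
      l₀-property S |S|≥l₀ with HasZero? S
      ... | yes z   = z
      ... | no ¬z = contradiction |S|≥l₀ (ℕ.<⇒≱ (s≤s (≡.subst (ℕ._≤ _) (ℕ.m*n/n≡m (length S) (1000 ℕ.^ n))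
        (ℕ./-monoˡ-≤ (1000 ℕ.^ n) (zeroFree-length (¬HasZero⇒ZeroFree ¬z))))))

      -- With the rounding, `l₀` is at most (1 + 6) · (C / 1000) ^ n, and one further factor C /
      -- 1000, being at least 7, absorbs the 7.
      l₀-≤ : l₀ ℕ.* 1000 ℕ.^ (n ℕ.+ 1) ℕ.≤ C ℕ.^ (n ℕ.+ 1)
      l₀-≤ = begin
        l₀ ℕ.* 1000 ℕ.^ (n ℕ.+ 1)                ≡⟨ ≡.cong (λ j → l₀ ℕ.* 1000 ℕ.^ j) (ℕ.+-comm n 1) ⟩
        l₀ ℕ.* (1000 ℕ.* 1000 ℕ.^ n)             ≡⟨ N.solve 2 (λ d p → (N.con 1 N.:+ d) N.:* (N.con 1000 N.:* p) N.:=
                                                                        N.con 1000 N.:* (p N.:+ d N.:* p))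
                                                    ≡.refl (6 ℕ.* C ℕ.^ n ℕ./ 1000 ℕ.^ n) (1000 ℕ.^ n) ⟩
        1000 ℕ.* (1000 ℕ.^ n ℕ.+ 6 ℕ.* C ℕ.^ n ℕ./ 1000 ℕ.^ n ℕ.* 1000 ℕ.^ n)
                                                 ≤⟨ ℕ.*-monoʳ-≤ 1000 (ℕ.+-mono-≤
                                                    (ℕ.^-monoˡ-≤ n (ℕ.≤-trans (ℕ.≤ᵇ⇒≤ 1000 7000 _) C≥7000))
                                                    (ℕ.m/n*n≤m _ (1000 ℕ.^ n))) ⟩
        1000 ℕ.* (C ℕ.^ n ℕ.+ 6 ℕ.* C ℕ.^ n)     ≡⟨ ℕ.*-assoc 1000 7 (C ℕ.^ n) ⟨
        7000 ℕ.* C ℕ.^ n                         ≤⟨ ℕ.*-monoˡ-≤ (C ℕ.^ n) C≥7000 ⟩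
        C ℕ.^ (1 ℕ.+ n)                          ≡⟨ ≡.cong (C ℕ.^_) (ℕ.+-comm 1 n) ⟩
        C ℕ.^ (n ℕ.+ 1)                          ∎
        where
        open ℕ.≤-Reasoning
        module N = +-*-Solver

      egz : ∃[ l ] (IsEGZ 3 (Power F n) 2 l × (+ l ℚ./ 1) ℚ.≤ (+ C ℚ./ 1000) ^ℚ (n ℕ.+ 1))
      egz with least-positive HasEGZProperty? {l₀} (s≤s z≤n) l₀-property
      ... | l , l≤l₀ , 0<l , has , least =
        l , record { positive = 0<l ; property = has ; minimal = least } ,
        ≤-/^ l C 1000 (n ℕ.+ 1) (ℕ.≤-trans (ℕ.*-monoˡ-≤ (1000 ℕ.^ (n ℕ.+ 1)) l≤l₀) l₀-≤)

-- The numerical rates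

module _ {c ℓ : Level} (k-1 : ℕ) (s t C : ℕ) (s≤t : s ℕ.≤ t) (C≥7000 : 7000 ℕ.≤ C) where

  private
    -- Copies of `Bounds.Q` and `growth` that do not mention the field, so that the rate condition
    -- can be settled by evaluation.
    Q G : ℕ
    Q = (s ℕ.* (t ℕ.* t)) ℕ.^ (suc k-1 ℕ.* 2)
    G = let open Weights s t s≤t in
      (weight 2 0 ℕ.+ (weight 1 1 ℕ.+ (weight 0 2 ℕ.+ 0))) ℕ.^ suc k-1 ℕ.∸ weight (suc k-1 ℕ.* 2) 0

  EGZ-rate : .{{_ : ℕ.NonZero Q}} → (G ℕ.+ Q) ℕ.* 1000 ℕ.≤ C ℕ.* Q →
             (F : CommutativeRing c ℓ) → IsFieldOfOrder F (3 ℕ.^ suc k-1) →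
             EGZ[ 3 , Power F , 2 ]≤ (+ C ℚ./ 1000) ^[n+o[n]]
  EGZ-rate rate F isField =
    -- The constant error term 1 is the spare factor C / 1000 used in `l₀-≤`.
    (λ _ → 1) , (λ r → r , λ n n≥r → ≡.subst (ℕ._≤ n) (≡.sym (ℕ.*-identityʳ r)) n≥r) ,
    0 , λ n _ → EGZ.egz F k-1 isField n s t C s≤t C≥7000 rate

open import Data.Nat.Base using (_^_)
open import Data.Rational.Base using (_/_)

theorem4p13 : {c ℓ : Level} (k : ℕ) (F : CommutativeRing c ℓ) → IsFieldOfOrder F (3 ^ k) →
    (k ≡ 2 → EGZ[ 3 , Power F , 2 ]≤ (+ 8315 / 1000) ^[n+o[n]])
    × (k ≡ 3 → EGZ[ 3 , Power F , 2 ]≤ (+ 21802 / 1000) ^[n+o[n]])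
    × (k ≡ 4 → EGZ[ 3 , Power F , 2 ]≤ (+ 58557 / 1000) ^[n+o[n]])
    × (k ≡ 5 → EGZ[ 3 , Power F , 2 ]≤ (+ 159812 / 1000) ^[n+o[n]])
-- s / t approximates the cube root of the minimiser of
-- ((1 + x + x ^ 2) ^ k - x ^ (2 k)) / x ^ (2 k / 3).
theorem4p13 k F isField =
    -- The evaluated inequalities are s ≤ t, 7000 ≤ C and the rate condition. In this case 1 + M is
    -- about 8.3144.
    (λ { ≡.refl → EGZ-rate 1 7 8 8315 (ℕ.≤ᵇ⇒≤ _ _ _) (ℕ.≤ᵇ⇒≤ _ _ _) (ℕ.≤ᵇ⇒≤ _ _ _) F isField })
  , (λ { ≡.refl → EGZ-rate 2 11 13 21802 (ℕ.≤ᵇ⇒≤ _ _ _) (ℕ.≤ᵇ⇒≤ _ _ _) (ℕ.≤ᵇ⇒≤ _ _ _) F isField })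
  , (λ { ≡.refl → EGZ-rate 3 16 19 58557 (ℕ.≤ᵇ⇒≤ _ _ _) (ℕ.≤ᵇ⇒≤ _ _ _) (ℕ.≤ᵇ⇒≤ _ _ _) F isField })
  , (λ { ≡.refl → EGZ-rate 4 11 13 159812 (ℕ.≤ᵇ⇒≤ _ _ _) (ℕ.≤ᵇ⇒≤ _ _ _) (ℕ.≤ᵇ⇒≤ _ _ _) F isField })
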